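{- Let $\lambda\ge 0$, $\eta$ and $\alpha_1,\dots,\alpha_\lambda$ be integers with $0<\alpha_1<\cdots<\alpha_\lambda<\eta$ and $\alpha_i=\eta-\alpha_{\lambda+1-i}$ for $1\le i\le\lambda$, and let $k,r$ be integers with $k\ge r\ge\lambda\ge0$ and $0\le\lambda<k-1$. Let $\chi(r=k)=1$ if $r=k$ and $0$ otherwise. There is a bijection $\Phi_0:\mathcal{D}_\eta\times\mathcal{B}_1(\alpha_1,\ldots,\alpha_\lambda;\eta,k-1,r-\chi(r=k))\to\overline{\mathcal{B}}_0(\alpha_1,\ldots,\alpha_\lambda;\eta,k,r)$ such that $|\Phi_0(\zeta,\mu)|=|\zeta|+|\mu|$ for all $(\zeta,\mu)$.
   Context: Overpartitions: the first occurrence of a part size may be overlined. Parts are ordered $1<\bar1<2<\bar2<\cdots$; $\pi=(\pi_1,\dots,\pi_s)$ with $\pi_1\ge\cdots\ge\pi_s$ in this order; inequalities between parts are in this order, and $x\pm\eta$ is the part of size $|x|\pm\eta$ overlined iff $x$ is. $[x/\eta]=\lfloor|x|/\eta\rfloor$; $\overline{V}_\pi(N)$ is the number of overlined parts of $\pi$ that are $\le N$; $|\pi|$ is the sum of the part sizes. For $j\in\{0,1\}$ and parameters $K,R$, $\overline{\mathcal{B}}_j(\alpha_1,\ldots,\alpha_\lambda;\eta,K,R)$ is the set of overpartitions $\pi=(\pi_1,\dots,\pi_s)$ (of any size) such that: (1) every part has size $\equiv 0,\alpha_1,\ldots,\alpha_\lambda\pmod\eta$; (2) only parts whose size is a multiple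 of $\eta$ may be non-overlined; (3) $\pi_i\ge\pi_{i+K-1}+\eta$ whenever $i+K-1\le s$, with strict inequality if $\pi_i$ is non-overlined; (4) at most $R-1$ parts satisfy $\pi_i\le\eta$; (5) whenever $i+K-2\le s$ and $\pi_i\le\pi_{i+K-2}+\eta$ with strict inequality if $\pi_i$ is overlined, then $[\pi_i/\eta]+\cdots+[\pi_{i+K-2}/\eta]\equiv R-1+\overline{V}_\pi(\pi_i)\pmod{2-j}$. The set $\mathcal{B}_j(\alpha_1,\ldots,\alpha_\lambda;\eta,K,R)$ consists of those $\pi\in\overline{\mathcal{B}}_j(\alpha_1,\ldots,\alpha_\lambda;\eta,K,R)$ having no overlined part whose size is a multiple of $\eta$. $\mathcal{D}_\eta$ is the set of partitions (including the empty one) into distinct parts each divisible by $\eta$. -}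

module Defs where

open import Data.Nat using (ℕ; zero; suc; _+_; _*_; _∸_; _≤_; _<_; NonZero; _≡ᵇ_)
open import Data.Nat.DivMod using (_/_; _%_)
open import Data.Nat.Divisibility using (_∣_)
open import Data.Bool using (Bool; true; false; if_then_else_)
open import Data.List using (List; []; _∷_; length; map; take; drop)
open import Data.Nat.ListAction using (sum)
open import Data.List.Relation.Unary.All using (All)
open import Data.List.Relation.Unary.Linked using (Linked)
open import Data.Maybe using (Maybe; just; nothing)
open import Data.Fin using (Fin)
open import Data.Product using (_×_; Σ; ∃)
open import Data.Sum using (_⊎_)
open import Relation.Binary.PropositionalEquality using (_≡_)
open import Relation.Nullary using (Dec; yes; no; ¬_)
import Data.Integer as ℤ
import Data.Integer.Divisibility as ℤD

record Part : Set where
  constructor part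
  field
    size : ℕ
    over : Bool
open Part public

-- The order 1 < 1̄ < 2 < 2̄ < ⋯ is encoded by the code 2·size + [overlined].
code : Part → ℕ
code p = 2 * size p + (if over p then 1 else 0)

_≤ₚ_ : Part → Part → Set
p ≤ₚ q = code p ≤ code q

_<ₚ_ : Part → Part → Set
p <ₚ q = code p < code q

_+ₚ_ : Part → ℕ → Part
p +ₚ n = part (size p + n) (over p)

plain : ℕ → Part
plain n = part n false

Adj : Part → Part → Set
Adj p q = (q <ₚ p) ⊎ (q ≡ p × over p ≡ false)

-- An overpartition: list of positive parts, nonincreasing in the order,
-- each part size overlined at most once (necessarily its first occurrence).
IsOverpartition : List Part → Set
IsOverpartition π = All (λ p → 1 ≤ size p) π × Linked Adj π

∣_∣ₒ : List Part → ℕ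
∣ π ∣ₒ = sum (map size π)

nth : List Part → ℕ → Maybe Part
nth []       _       = nothing
nth (x ∷ xs) zero    = just x
nth (x ∷ xs) (suc n) = nth xs n

decide≤ : ℕ → ℕ → Bool
decide≤ m n with m Data.Nat.≤? n
... | yes _ = true
... | no  _ = false

countWhere : (Part → Bool) → List Part → ℕ
countWhere f []       = 0
countWhere f (x ∷ xs) = (if f x then 1 else 0) + countWhere f xs

Vbar : List Part → Part → ℕ
Vbar π N = countWhere (λ p → if over p then decide≤ (code p) (code N) else false) π

CongMod : ℕ → ℕ → ℕ → Set
CongMod m a b = (ℤ.+ m) ℤD.∣ ((ℤ.+ a) ℤ.- (ℤ.+ b))

module _ (η : ℕ) .{{_ : NonZero η}} where

  fl : Part → ℕ
  fl p = size p / η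

  -- Conditions (1)-(5) defining B̄_j(α_1..α_λ; η, K, R), for j ∈ {0,1}
  -- (the modulus 2 - j is written 2 ∸ j).
  record InBbar {lam : ℕ} (α : Fin lam → ℕ) (j K R : ℕ) (π : List Part) : Set where
    field
      overpartition : IsOverpartition π
      cond1 : All (λ p → size p % η ≡ 0 ⊎ ∃ λ (i : Fin lam) → size p % η ≡ α i) π
      cond2 : All (λ p → over p ≡ false → η ∣ size p) π
      cond3 : ∀ (i : ℕ) (p q : Part) → nth π i ≡ just p → nth π (i + (K ∸ 1)) ≡ just q →
                ((q +ₚ η) ≤ₚ p) × (over p ≡ false → (q +ₚ η) <ₚ p)
      cond4 : countWhere (λ p → decide≤ (code p) (code (plain η))) π + 1 ≤ R
      cond5 : ∀ (i : ℕ) (p q : Part) → nth π i ≡ just p → nth π (i + (K ∸ 2)) ≡ just q →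
                p ≤ₚ (q +ₚ η) → (over p ≡ true → p <ₚ (q +ₚ η)) →
                CongMod (2 ∸ j) (sum (map fl (take (K ∸ 1) (drop i π))) + 1) (R + Vbar π p)

  InB : {lam : ℕ} (α : Fin lam → ℕ) (j K R : ℕ) (π : List Part) → Set
  InB α j K R π = InBbar α j K R π × All (λ p → over p ≡ true → ¬ (η ∣ size p)) π

  InD : List Part → Set
  InD π = All (λ p → 1 ≤ size p × over p ≡ false × η ∣ size p) π
          × Linked (λ p q → q <ₚ p) π

χ= : ℕ → ℕ → ℕ
χ= r k = if r ≡ᵇ k then 1 else 0

{-# OPTIONS --safe #-}
module Submission where

open import Defs
open import Data.Bool using (Bool; true; false; if_then_else_; T)
open import Data.Bool.Properties using () renaming (_≟_ to _≟ᵇ_)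
open import Data.Empty using (⊥-elim)
open import Data.Fin using (Fin; zero; suc; opposite) renaming (_<_ to _<ᶠ_)
open import Data.Fin.Properties using (¬Fin0)
open import Data.Integer.Base as ℤ using (_⊖_)
import Data.Integer.Properties as ℤ
open import Data.List using (List; []; _∷_; length; map; filter; _++_; take; drop; replicate)
open import Data.List.Membership.Propositional using (_∈_)
open import Data.List.Properties using (filter-accept; filter-reject; filter-none; filter-all; filter-++; ++-identityʳ; length-++; ++-assoc)
open import Data.List.Relation.Unary.All as All using (All; []; _∷_)
open import Data.List.Relation.Unary.All.Properties as All using ()
open import Data.List.Relation.Unary.AllPairs as AllPairs using (AllPairs; []; _∷_)
open import Data.List.Relation.Unary.AllPairs.Properties as AllPairs using ()
open import Data.List.Relation.Unary.Any using (here; there)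
open import Data.List.Relation.Unary.Linked.Properties using (Linked⇒AllPairs; AllPairs⇒Linked)
open import Data.Maybe using (just)
open import Data.Nat
open import Data.Nat.DivMod using (_/_; _%_; m≡m%n+[m/n]*n; m%n<n; m/n*n≤m; m<n*o⇒m/o<n; m*n/n≡m; /-mono-≤)
open import Data.Nat.Divisibility using (_∣_; divides; _∣?_; 1∣_; ∣m∣n⇒∣m+n; m%n≡0⇒n∣m; n∣m⇒m%n≡0)
open import Data.Nat.ListAction using (sum)
open import Data.Nat.Properties
open import Data.Nat.Tactic.RingSolver using (solve-∀)
open import Data.Parity.Base as ℙ using (Parity; 0ℙ; 1ℙ)
open import Data.Parity.Properties as ℙ using ()
open import Data.Product using (_×_; _,_; proj₁; proj₂; ∃; ∃₂; Σ)
open import Data.Sum using (_⊎_; inj₁; inj₂)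
open import Data.Unit using (tt)
open import Function using (_∘_)
open import Relation.Binary.PropositionalEquality
open import Relation.Nullary using (Dec; yes; no; ¬_; ¬?; _×-dec_; does)
open import Relation.Unary using (Decidable)

-- Write n_m for the number of parts of size mη.  The bijection preserves all sizes and all parts that are
-- not multiples of η; at level m it only trades the part of ζ (d_m ∈ {0, 1}) for an overline (b_m ∈ {0, 1}).
-- A window of k - 1 parts of π contains mη for one level m, and for every such window condition (5) says
-- the same thing: the number a_m of plain parts mη has the parity P_m = R - 1 + (m - 1)(k - 1) + V_m, with V_m
-- the number of overlined parts below mη.  Hence all window conditions at level m read "size of the window
-- plus u_m ≤ k - 1", where u_m = [a_m ≢ P_m].  Matching d_m = 1 - u_m whenever n_m > 0 gives
-- n_m + u_m = c_m + 1 for the number c_m of parts mη of μ, which turns these inequalities into those for μ;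
-- the remaining discrepancies of 1 are absorbed by parity.  As V_m involves lower levels only, b_m
-- and d_m determine each other recursively in m.

-- Counting in lists

-- Conditions (3) and (5) speak of positions in a list, and positions in `μ` and in `π` do not
-- correspond. They are therefore restated as bounds for a window at every possible threshold,
-- whether or not it occurs as a part; these involve multiplicities only. An overlined threshold
-- meets exactly one multiple of η, and there the bounds for `π` and `μ` agree term by term on an
-- occupied level. The plain threshold (m + 1)η meets two adjacent levels, but only u_{m+1} enters
-- its bound and the overlined part (m + 1)η lies outside the window: this is the source of the
-- discrepancies of 1. An empty level has no relation between u_m and d_m; its bounds hold because
-- at most λ ≤ k - 2 non-multiples fit into η consecutive sizes. For r = k, condition (4) follows
-- from the window bounds on either side, and those of `μ` are tighter by one; hence r - 1 in place
-- of r.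

𝟙 : {X : Set} → Dec X → ℕ
𝟙 (yes _) = 1
𝟙 (no  _) = 0

module _ {A : Set} where

  cnt : {P : A → Set} → Decidable P → List A → ℕ
  cnt P? xs = length (filter P? xs)

  module _ {P : A → Set} (P? : Decidable P) where

    cnt-accept : ∀ {x xs} → P x → cnt P? (x ∷ xs) ≡ suc (cnt P? xs)
    cnt-accept px = cong length (filter-accept P? px)

    cnt-reject : ∀ {x xs} → ¬ P x → cnt P? (x ∷ xs) ≡ cnt P? xs
    cnt-reject ¬px = cong length (filter-reject P? ¬px)

    cnt-∷ : ∀ x xs → cnt P? (x ∷ xs) ≡ 𝟙 (P? x) + cnt P? xs
    cnt-∷ x xs with P? x
    ... | yes _ = refl
    ... | no  _ = refl

    cnt-none : ∀ {xs} → All (¬_ ∘ P) xs → cnt P? xs ≡ 0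
    cnt-none ¬ps = cong length (filter-none P? ¬ps)

    cnt≤1 : ∀ {xs} → AllPairs (λ x y → P x → ¬ P y) xs → cnt P? xs ≤ 1
    cnt≤1 {[]}     []         = z≤n
    cnt≤1 {x ∷ xs} (pr ∷ prs) with P? x
    ... | yes px = s≤s (≤-reflexive (cnt-none (All.map (λ f → f px) pr)))
    ... | no  _  = cnt≤1 prs

    cnt-witness : ∀ {xs} → 0 < cnt P? xs → ∃ λ x → x ∈ xs × P x
    cnt-witness {x ∷ xs} pos with P? x
    ... | yes px = x , here refl , px
    ... | no  _  = let y , y∈ , py = cnt-witness pos in y , there y∈ , py

    cnt-∈ : ∀ {x xs} → x ∈ xs → P x → 0 < cnt P? xs
    cnt-∈ {xs = xs} (here refl) px = subst (0 <_) (sym (cnt-accept px)) (s≤s z≤n)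
    cnt-∈ {xs = y ∷ xs} (there x∈) px with P? y
    ... | yes _ = s≤s z≤n
    ... | no  _ = cnt-∈ x∈ px

  module _ {P Q : A → Set} (P? : Decidable P) (Q? : Decidable Q) where

    cnt-cong : ∀ xs → All (λ x → (P x → Q x) × (Q x → P x)) xs → cnt P? xs ≡ cnt Q? xs
    cnt-cong []       []            = refl
    cnt-cong (x ∷ xs) ((f , g) ∷ h) with P? x
    ... | yes px = trans (cong suc (cnt-cong xs h)) (sym (cnt-accept Q? (f px)))
    ... | no ¬px = trans (cnt-cong xs h) (sym (cnt-reject Q? (¬px ∘ g)))

    cnt-mono : ∀ xs → All (λ x → P x → Q x) xs → cnt P? xs ≤ cnt Q? xs
    cnt-mono []       []      = z≤n
    cnt-mono (x ∷ xs) (f ∷ h) with P? x | Q? x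
    ... | yes px | yes _  = s≤s (cnt-mono xs h)
    ... | yes px | no ¬qx = ⊥-elim (¬qx (f px))
    ... | no  _  | yes _  = m≤n⇒m≤1+n (cnt-mono xs h)
    ... | no  _  | no  _  = cnt-mono xs h

  module _ {P Q R : A → Set} (P? : Decidable P) (Q? : Decidable Q) (R? : Decidable R) where

    -- The disjoint-union property is asked only of the members of `xs`, so that facts holding
    -- inside a given overpartition, such as `Shape`, can be used. The counts of windows and ranges
    -- by level are all split in this way.
    cnt-⊎ : ∀ xs →
      All (λ x → (P x → Q x ⊎ R x) × (Q x → P x × ¬ R x) × (R x → P x)) xs →
      cnt P? xs ≡ cnt Q? xs + cnt R? xs
    cnt-⊎ [] [] = refl
    cnt-⊎ (x ∷ xs) ((f , g , h) ∷ rest) with P? x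
    ... | no ¬px = trans (cnt-⊎ xs rest)
          (cong₂ _+_ (sym (cnt-reject Q? (¬px ∘ proj₁ ∘ g))) (sym (cnt-reject R? (¬px ∘ h))))
    ... | yes px with f px
    ...   | inj₁ qx = trans (cong suc (cnt-⊎ xs rest))
          (cong₂ _+_ (sym (cnt-accept Q? qx)) (sym (cnt-reject R? (proj₂ (g qx)))))
    ...   | inj₂ rx = trans (cong suc (cnt-⊎ xs rest))
          (trans (sym (+-suc _ _))
          (cong₂ _+_ (sym (cnt-reject Q? (λ qx → proj₂ (g qx) rx))) (sym (cnt-accept R? rx))))

  cnt-++ : {P : A → Set} (P? : Decidable P) (xs ys : List A) →
    cnt P? (xs ++ ys) ≡ cnt P? xs + cnt P? ys
  cnt-++ P? []       ys = refl
  cnt-++ P? (x ∷ xs) ys with P? x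
  ... | yes _ = cong suc (cnt-++ P? xs ys)
  ... | no  _ = cnt-++ P? xs ys

  -- Pigeonhole by removing one class at a time. The recursive call counts only what lies outside
  -- class `zero`, so the classes may overlap.
  cnt≤classes : ∀ n {P : A → Set} (P? : Decidable P) {Q : Fin n → A → Set} (Q? : ∀ i → Decidable (Q i)) xs →
    All (λ x → P x → ∃ λ i → Q i x) xs → (∀ i → cnt (λ x → P? x ×-dec Q? i x) xs ≤ 1) → cnt P? xs ≤ n
  cnt≤classes zero P? Q? xs cover few = ≤-reflexive (cnt-none P? (All.map (λ f px → ¬Fin0 (proj₁ (f px))) cover))
  cnt≤classes (suc n) {P} P? {Q} Q? xs cover few =
    ≤-trans (≤-reflexive (cnt-⊎ P? (λ x → P? x ×-dec Q? zero x) P′? xs (All.tabulate λ {x} _ → split x)))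
      (+-mono-≤ (few zero) (cnt≤classes n P′? (Q? ∘ suc) xs (All.map shift cover)
        λ i → ≤-trans (cnt-mono (λ x → P′? x ×-dec Q? (suc i) x) (λ x → P? x ×-dec Q? (suc i) x) xs
                         (All.tabulate λ _ ((p , _) , q) → p , q))
                       (few (suc i))))
    where
    P′? : Decidable (λ x → P x × ¬ Q zero x)
    P′? x = P? x ×-dec ¬? (Q? zero x)
    split : ∀ x → (P x → P x × Q zero x ⊎ P x × ¬ Q zero x) ×
      (P x × Q zero x → P x × ¬ (P x × ¬ Q zero x)) × (P x × ¬ Q zero x → P x)
    split x = to , (λ (p , q) → p , λ (_ , ¬q) → ¬q q) , proj₁
      where
      to : P x → P x × Q zero x ⊎ P x × ¬ Q zero x
      to px with Q? zero x
      ... | yes q = inj₁ (px , q)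
      ... | no ¬q = inj₂ (px , ¬q)
    shift : ∀ {x} → (P x → ∃ λ i → Q i x) → P x × ¬ Q zero x → ∃ λ i → Q (suc i) x
    shift f (px , ¬q) with f px
    ... | zero  , q = ⊥-elim (¬q q)
    ... | suc i , q = i , q

-- Sums and counts determined by multiplicities

Σ< : ℕ → (ℕ → ℕ) → ℕ
Σ< zero    f = 0
Σ< (suc n) f = f n + Σ< n f

Σ<-cong : ∀ n {f g : ℕ → ℕ} → (∀ i → f i ≡ g i) → Σ< n f ≡ Σ< n g
Σ<-cong zero    eq = refl
Σ<-cong (suc n) eq = cong₂ _+_ (eq n) (Σ<-cong n eq)

Σ<-zero : ∀ n {f : ℕ → ℕ} → (∀ i → i < n → f i ≡ 0) → Σ< n f ≡ 0
Σ<-zero zero    _  = refl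
Σ<-zero (suc n) eq = cong₂ _+_ (eq n ≤-refl) (Σ<-zero n λ i i<n → eq i (m≤n⇒m≤1+n i<n))

Σ<-+ : ∀ n (f g : ℕ → ℕ) → Σ< n (λ i → f i + g i) ≡ Σ< n f + Σ< n g
Σ<-+ zero    f g = refl
Σ<-+ (suc n) f g = trans (cong (f n + g n +_) (Σ<-+ n f g)) (interchange (f n) (g n) _ _)
  where
  interchange : ∀ a b c d → a + b + (c + d) ≡ a + c + (b + d)
  interchange = solve-∀

Σ<-point : ∀ n (w : ℕ → ℕ) x → x < n → Σ< n (λ s → w s * 𝟙 (x ≟ s)) ≡ w x
Σ<-point (suc n) w x x<1+n with x ≟ n
... | yes refl = trans (cong₂ _+_ (*-identityʳ (w n)) (Σ<-zero n below)) (+-identityʳ (w n))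
  where
  below : ∀ i → i < n → w i * 𝟙 (n ≟ i) ≡ 0
  below i i<n with n ≟ i
  ... | yes refl = ⊥-elim (<-irrefl refl i<n)
  ... | no  _    = *-zeroʳ (w i)
... | no  x≢n  = trans (cong (_+ Σ< n (λ s → w s * 𝟙 (x ≟ s))) (*-zeroʳ (w n)))
                   (Σ<-point n w x (≤∧≢⇒< (s≤s⁻¹ x<1+n) x≢n))

module _ {A : Set} (key : A → ℕ) where

  cntKey : List A → ℕ → ℕ
  cntKey xs s = cnt (λ x → key x ≟ s) xs

  -- Interchange of summation. The bound `B` is left free so that several lists can be summed over
  -- one common range.
  sum-by-key : ∀ B (w : ℕ → ℕ) {xs} → All (λ x → key x < B) xs →
    sum (map (w ∘ key) xs) ≡ Σ< B (λ s → w s * cntKey xs s)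
  sum-by-key B w []                 = sym (Σ<-zero B λ i _ → *-zeroʳ (w i))
  sum-by-key B w {x ∷ xs} (x< ∷ xs<) = begin
    w (key x) + sum (map (w ∘ key) xs)
      ≡⟨ cong₂ _+_ (sym (Σ<-point B w (key x) x<)) (sum-by-key B w xs<) ⟩
    Σ< B (λ s → w s * 𝟙 (key x ≟ s)) + Σ< B (λ s → w s * cntKey xs s)
      ≡⟨ Σ<-+ B _ _ ⟨
    Σ< B (λ s → w s * 𝟙 (key x ≟ s) + w s * cntKey xs s)
      ≡⟨ Σ<-cong B (λ s → trans (sym (*-distribˡ-+ (w s) _ _)) (cong (w s *_) (sym (cnt-∷ (λ y → key y ≟ s) x xs)))) ⟩
    Σ< B (λ s → w s * cntKey (x ∷ xs) s) ∎
    where open ≡-Reasoning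

  cnt-as-sum : {P : ℕ → Set} (P? : Decidable P) (xs : List A) →
    cnt (λ x → P? (key x)) xs ≡ sum (map ((λ s → 𝟙 (P? s)) ∘ key) xs)
  cnt-as-sum P? []       = refl
  cnt-as-sum P? (x ∷ xs) with P? (key x)
  ... | yes _ = cong suc (cnt-as-sum P? xs)
  ... | no  _ = cnt-as-sum P? xs

  key-bounded : (xs : List A) → All (λ x → key x < suc (sum (map key xs))) xs
  key-bounded []       = []
  key-bounded (x ∷ xs) = s≤s (m≤m+n _ _) ∷
    All.map (λ lt → ≤-trans lt (s≤s (m≤n+m _ (key x)))) (key-bounded xs)

  -- Both counts are the same weighted sum of multiplicities, and keys outside `P` have weight 0.
  -- With `P` confined to non-multiples of η it carries counts between lists that differ at the
  -- multiples.
  cntKey-local : {P : ℕ → Set} (P? : Decidable P) (xs ys : List A) →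
    (∀ s → P s → cntKey xs s ≡ cntKey ys s) →
    cnt (λ x → P? (key x)) xs ≡ cnt (λ x → P? (key x)) ys
  cntKey-local P? xs ys eq = begin
    cnt (λ x → P? (key x)) xs            ≡⟨ cnt-as-sum P? xs ⟩
    sum (map ((λ s → 𝟙 (P? s)) ∘ key) xs) ≡⟨ sum-by-key B (λ s → 𝟙 (P? s)) (All.map (λ lt → ≤-trans lt (s≤s (m≤m+n _ _))) (key-bounded xs)) ⟩
    Σ< B (λ s → 𝟙 (P? s) * cntKey xs s)   ≡⟨ Σ<-cong B pointwise ⟩
    Σ< B (λ s → 𝟙 (P? s) * cntKey ys s)   ≡⟨ sum-by-key B (λ s → 𝟙 (P? s)) (All.map (λ lt → ≤-trans lt (s≤s (m≤n+m _ _))) (key-bounded ys)) ⟨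
    sum (map ((λ s → 𝟙 (P? s)) ∘ key) ys) ≡⟨ cnt-as-sum P? ys ⟨
    cnt (λ x → P? (key x)) ys ∎
    where
    open ≡-Reasoning
    B = suc (sum (map key xs) + sum (map key ys))
    pointwise : ∀ s → 𝟙 (P? s) * cntKey xs s ≡ 𝟙 (P? s) * cntKey ys s
    pointwise s with P? s
    ... | yes p = cong (1 *_) (eq s p)
    ... | no  _ = refl

  sum-additive : (xs ys zs : List A) → (∀ s → cntKey xs s ≡ cntKey ys s + cntKey zs s) →
    sum (map key xs) ≡ sum (map key ys) + sum (map key zs)
  sum-additive xs ys zs eq = begin
    sum (map key xs)                              ≡⟨ sum-by-key B (λ s → s) (All.map (λ lt → ≤-trans lt (s≤s (m≤m+n _ _))) (key-bounded xs)) ⟩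
    Σ< B (λ s → s * cntKey xs s)                  ≡⟨ Σ<-cong B (λ s → trans (cong (s *_) (eq s)) (*-distribˡ-+ s _ _)) ⟩
    Σ< B (λ s → s * cntKey ys s + s * cntKey zs s) ≡⟨ Σ<-+ B (λ s → s * cntKey ys s) (λ s → s * cntKey zs s) ⟩
    Σ< B (λ s → s * cntKey ys s) + Σ< B (λ s → s * cntKey zs s)
      ≡⟨ cong₂ _+_ (sum-by-key B (λ s → s) (All.map (λ lt → ≤-trans lt (s≤s (≤-trans (m≤m+n _ _) (m≤n+m _ (sum (map key xs)))))) (key-bounded ys)))
                   (sum-by-key B (λ s → s) (All.map (λ lt → ≤-trans lt (s≤s (≤-trans (m≤n+m _ (sum (map key ys))) (m≤n+m _ (sum (map key xs)))))) (key-bounded zs))) ⟨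
    sum (map key ys) + sum (map key zs) ∎
    where
    open ≡-Reasoning
    B = suc (sum (map key xs) + (sum (map key ys) + sum (map key zs)))

-- Windows of sorted lists

bit : Bool → ℕ
bit b = if b then 1 else 0

-- ⌈ code p / 2 ⌉; the gap conditions (3) and (5) on p and q compare it with size q + η.
rise : Part → ℕ
rise p = size p + bit (over p)

code-over : ∀ s → code (part s true) ≡ suc (2 * s)
code-over s = +-comm (2 * s) 1

code-plain : ∀ s → code (plain s) ≡ 2 * s
code-plain s = +-identityʳ (2 * s)

bit≤1 : ∀ b → bit b ≤ 1
bit≤1 true  = ≤-refl
bit≤1 false = z≤n

2size≤code : ∀ q → 2 * size q ≤ code q
2size≤code q = m≤m+n _ _

code<2+2size : ∀ q → code q < 2 * suc (size q)
code<2+2size q = subst (code q <_) (sym (*-suc 2 (size q)))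
  (s≤s (subst (code q ≤_) (+-comm (2 * size q) 1) (+-monoʳ-≤ (2 * size q) (bit≤1 (over q)))))

code<plain⁺ : ∀ q {s} → size q < s → code q < code (plain s)
code<plain⁺ q {s} lt = subst (code q <_) (sym (code-plain s)) (≤-trans (code<2+2size q) (*-monoʳ-≤ 2 lt))

code<plain⁻ : ∀ q {s} → code q < code (plain s) → size q < s
code<plain⁻ q {s} lt = *-cancelˡ-< 2 (size q) s (≤-<-trans (2size≤code q) (subst (code q <_) (code-plain s) lt))

code≤over⁺ : ∀ q {s} → size q ≤ s → code q ≤ code (part s true)
code≤over⁺ q {s} le = subst (code q ≤_) (sym (code-over s))
  (s≤s⁻¹ (subst (code q <_) (*-suc 2 s) (≤-trans (code<2+2size q) (*-monoʳ-≤ 2 (s≤s le)))))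

code≤over⁻ : ∀ q {s} → code q ≤ code (part s true) → size q ≤ s
code≤over⁻ q {s} le = s≤s⁻¹ (*-cancelˡ-< 2 (size q) (suc s)
  (subst (2 * size q <_) (sym (*-suc 2 s)) (s≤s (≤-trans (2size≤code q) (subst (code q ≤_) (code-over s) le)))))

code≤plain⁻ : ∀ q {s} → code q ≤ code (plain s) → size q < s ⊎ size q ≡ s × over q ≡ false
code≤plain⁻ (part t false) {s} le with m≤n⇒m<n∨m≡n (*-cancelˡ-≤ 2 (subst₂ _≤_ (code-plain t) (code-plain s) le))
... | inj₁ lt = inj₁ lt
... | inj₂ eq = inj₂ (eq , refl)
code≤plain⁻ (part t true) {s} le =
  inj₁ (*-cancelˡ-< 2 t s (subst₂ _≤_ (code-over t) (code-plain s) le))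

code-injective : ∀ p q → code p ≡ code q → p ≡ q
code-injective (part s true) q eq with code≤over⁻ q {s} (≤-reflexive (sym eq))
code-injective (part s true) (part t true) eq | _ =
  cong (λ x → part x true) (*-cancelˡ-≡ s t 2 (suc-injective (trans (sym (code-over s)) (trans eq (code-over t)))))
code-injective (part s true) (part t false) eq | t≤s =
  ⊥-elim (<-irrefl (sym eq) (subst₂ _<_ (sym (code-plain t)) (sym (code-over s)) (s≤s (*-monoʳ-≤ 2 t≤s))))
code-injective (part s false) q eq with code≤plain⁻ q {s} (≤-reflexive (sym eq))
... | inj₁ lt            = ⊥-elim (<-irrefl (sym eq) (code<plain⁺ q lt))
... | inj₂ (refl , refl) = refl

code≤⇒size≤ : ∀ p q → code p ≤ code q → size p ≤ size q
code≤⇒size≤ p (part t true)  le = code≤over⁻ p le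
code≤⇒size≤ p (part t false) le with code≤plain⁻ p le
... | inj₁ lt       = <⇒≤ lt
... | inj₂ (eq , _) = ≤-reflexive eq

code≤⇒rise≤ : ∀ p q → code p ≤ code q → rise p ≤ rise q
code≤⇒rise≤ p (part t true)  le = +-mono-≤ (code≤over⁻ p le) (bit≤1 (over p))
code≤⇒rise≤ p (part t false) le with code≤plain⁻ p le
... | inj₁ lt           = ≤-trans (+-monoʳ-≤ (size p) (bit≤1 (over p)))
                            (subst₂ _≤_ (+-comm 1 (size p)) (sym (+-identityʳ t)) lt)
... | inj₂ (refl , eq) rewrite eq = ≤-refl

Adj-trans : ∀ {p q s} → Adj p q → Adj q s → Adj p s
Adj-trans (inj₁ q<p)         (inj₁ s<q)         = inj₁ (<-trans s<q q<p)
Adj-trans (inj₁ q<p)         (inj₂ (refl , _))  = inj₁ q<p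
Adj-trans (inj₂ (refl , _))  a                  = a

Adj⇒code≤ : ∀ {p q} → Adj p q → code q ≤ code p
Adj⇒code≤ (inj₁ q<p)        = <⇒≤ q<p
Adj⇒code≤ (inj₂ (refl , _)) = ≤-refl

Sorted : List Part → Set
Sorted = AllPairs (λ p q → code q ≤ code p)

overpartition⇒sorted : ∀ {π} → IsOverpartition π → Sorted π
overpartition⇒sorted (_ , lnk) = AllPairs.map Adj⇒code≤ (Linked⇒AllPairs Adj-trans lnk)

split-monotone : {A : Set} {P : A → Set} (P? : Decidable P) {xs : List A} →
  AllPairs (λ x y → P y → P x) xs → ∃₂ λ us vs → xs ≡ us ++ vs × All P us × All (¬_ ∘ P) vs
split-monotone P? []         = [] , [] , refl , [] , []
split-monotone P? {x ∷ xs} (h ∷ hs) with P? x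
... | yes px = let us , vs , eq , ps , nps = split-monotone P? hs in
               x ∷ us , vs , cong (x ∷_) eq , px ∷ ps , nps
... | no ¬px = [] , x ∷ xs , refl , [] , ¬px ∷ All.map (λ f py → ¬px (f py)) h

nth-++ʳ : ∀ us vs j → nth (us ++ vs) (length us + j) ≡ nth vs j
nth-++ʳ []       vs j = refl
nth-++ʳ (u ∷ us) vs j = nth-++ʳ us vs j

nth-++ˡ : ∀ us vs {j} → j < length us → nth (us ++ vs) j ≡ nth us j
nth-++ˡ (u ∷ us) vs {zero}  lt       = refl
nth-++ˡ (u ∷ us) vs {suc j} (s≤s lt) = nth-++ˡ us vs lt

nth-just : ∀ xs {j} → j < length xs → ∃ λ q → nth xs j ≡ just q
nth-just (x ∷ xs) {zero}  lt       = x , refl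
nth-just (x ∷ xs) {suc j} (s≤s lt) = nth-just xs lt

nth-All : ∀ {P : Part → Set} {xs} j {q} → All P xs → nth xs j ≡ just q → P q
nth-All zero    (px ∷ _)  refl = px
nth-All (suc j) (_ ∷ pxs) eq   = nth-All j pxs eq

take-length : ∀ (us vs : List Part) → take (length us) (us ++ vs) ≡ us
take-length []       vs = refl
take-length (u ∷ us) vs = cong (u ∷_) (take-length us vs)

drop-length : ∀ (us vs : List Part) → drop (length us) (us ++ vs) ≡ vs
drop-length []       vs = refl
drop-length (u ∷ us) vs = drop-length us vs

module Windows (η : ℕ) where

  -- The members at or below `p` that are too close to it for condition (3). The threshold `p` need
  -- not occur in the list, which makes sense of a window at every size.
  Win : Part → Part → Set
  Win p q = code q ≤ code p × rise p ≤ size q + η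

  Win? : ∀ p → Decidable (Win p)
  Win? p q = (code q ≤? code p) ×-dec (rise p ≤? size q + η)

  Far : Part → Part → Set
  Far p q = ((q +ₚ η) ≤ₚ p) × (over p ≡ false → (q +ₚ η) <ₚ p)

  -- An overlined part is the largest of its size, so a weak inequality below it compares sizes
  -- only; a plain part is the smallest of its size, so a strict inequality below it does the same.
  -- Hence the overline of `q` never matters, and `Near` is the exact complement of `Far`.
  far⇒ : ∀ p q → Far p q → size q + η < rise p
  far⇒ (part s true)  q (h , _) = subst (size q + η <_) (+-comm 1 s) (s≤s (code≤over⁻ (q +ₚ η) h))
  far⇒ (part s false) q (_ , h) = subst (size q + η <_) (sym (+-identityʳ s)) (code<plain⁻ (q +ₚ η) (h refl))

  far⇐ : ∀ p q → size q + η < rise p → Far p q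
  far⇐ (part s true)  q lt = code≤over⁺ (q +ₚ η) (s≤s⁻¹ (subst (size q + η <_) (+-comm s 1) lt)) , λ ()
  far⇐ (part s false) q lt = <⇒≤ lt′ , λ _ → lt′
    where lt′ = code<plain⁺ (q +ₚ η) (subst (size q + η <_) (+-identityʳ s) lt)

  Near : Part → Part → Set
  Near p q = p ≤ₚ (q +ₚ η) × (over p ≡ true → p <ₚ (q +ₚ η))

  near⇒ : ∀ p q → Near p q → rise p ≤ size q + η
  near⇒ p@(part s true)  q (_ , h) = ≮⇒≥ λ lt → <⇒≱ (h refl) (proj₁ (far⇐ p q lt))
  near⇒ p@(part s false) q (h , _) = ≮⇒≥ λ lt → <⇒≱ (proj₂ (far⇐ p q lt) refl) h

  near⇐ : ∀ p q → rise p ≤ size q + η → Near p q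
  near⇐ p@(part s true)  q le = <⇒≤ lt , λ _ → lt
    where lt = ≰⇒> λ h → <⇒≱ (far⇒ p q (h , λ ())) le
  near⇐ p@(part s false) q le = (≮⇒≥ λ h → <⇒≱ (far⇒ p q (<⇒≤ h , λ _ → h)) le) , λ ()

  record Decomposition (p : Part) (π : List Part) : Set where
    field
      U W Z : List Part
      glue  : π ≡ U ++ (W ++ Z)
      above : All (λ q → code p < code q) U
      within : All (Win p) W
      below : All (λ q → code q ≤ code p × size q + η < rise p) Z

  -- Both tests defining `Win p` are monotone along a sorted list, so a window is a contiguous block
  -- and can be compared with `take` and `drop`.
  decompose : ∀ p {π} → Sorted π → Decomposition p π
  decompose p {π} sorted with split-monotone (λ q → code p <? code q) (AllPairs.map (λ le lt → <-≤-trans lt le) sorted)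
  ... | U , V , refl , above , ¬above
      with split-monotone (λ q → rise p ≤? size q + η)
             (AllPairs.map (λ {x} {y} le h → ≤-trans h (+-monoˡ-≤ η (code≤⇒size≤ y x le))) (++ʳ U sorted))
    where
    ++ʳ : ∀ U {V} → Sorted (U ++ V) → Sorted V
    ++ʳ []      s       = s
    ++ʳ (_ ∷ U) (_ ∷ s) = ++ʳ U s
  ...   | W , Z , refl , near , ¬near = record
    { U = U ; W = W ; Z = Z ; glue = refl ; above = above
    ; within = All.zipWith (λ (a , b) → ≮⇒≥ a , b) (All.++⁻ˡ W ¬above , near)
    ; below = All.zipWith (λ (a , b) → ≮⇒≥ a , ≰⇒> b) (All.++⁻ʳ W ¬above , ¬near) }

  module _ {p π} (dec : Decomposition p π) where
    open Decomposition dec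

    filter-Win : filter (Win? p) π ≡ W
    filter-Win = begin
      filter (Win? p) π                    ≡⟨ cong (filter (Win? p)) glue ⟩
      filter (Win? p) (U ++ (W ++ Z))      ≡⟨ filter-++ (Win? p) U (W ++ Z) ⟩
      filter (Win? p) U ++ filter (Win? p) (W ++ Z)
        ≡⟨ cong₂ _++_ (filter-none (Win? p) (All.map (λ lt w → <⇒≱ lt (proj₁ w)) above))
                      (filter-++ (Win? p) W Z) ⟩
      filter (Win? p) W ++ filter (Win? p) Z
        ≡⟨ cong₂ _++_ (filter-all (Win? p) within)
                      (filter-none (Win? p) (All.map (λ b w → <⇒≱ (proj₂ b) (proj₂ w)) below)) ⟩
      W ++ []                              ≡⟨ ++-identityʳ W ⟩
      W ∎
      where open ≡-Reasoning

    nth-W : ∀ {j} → j < length W → nth π (length U + j) ≡ nth W j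
    nth-W lt = trans (cong (λ xs → nth xs _) glue) (trans (nth-++ʳ U (W ++ Z) _) (nth-++ˡ W Z lt))

    block-W : ∀ {i n} → i ≡ length U → length W ≡ n → take n (drop i π) ≡ filter (Win? p) π
    block-W refl refl = trans (cong (take (length W)) (trans (cong (drop (length U)) glue) (drop-length U (W ++ Z))))
      (trans (take-length W Z) (sym filter-Win))

    U≤index : ∀ i {q} → nth π i ≡ just q → code q ≤ code p → length U ≤ i
    U≤index i {q} eq le = ≮⇒≥ λ lt →
      <⇒≱ (nth-All i above (trans (sym (nth-++ˡ U (W ++ Z) lt)) (trans (cong (λ xs → nth xs i) (sym glue)) eq))) le

    index<UW : ∀ i {q} → nth π i ≡ just q → rise p ≤ size q + η → i < length U + length W
    index<UW i {q} eq le = ≰⇒> λ ge →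
      <⇒≱ (proj₂ (nth-All (i ∸ (length U + length W)) below
        (trans (sym (nth-++ʳ (U ++ W) Z _))
          (trans (cong₂ nth (++-assoc-glue)
            (trans (cong (_+ (i ∸ (length U + length W))) (length-++ U)) (m+[n∸m]≡n ge))) eq)))) le
      where
      ++-assoc-glue : (U ++ W) ++ Z ≡ π
      ++-assoc-glue = trans (++-assoc U W Z) (sym glue)

  module _ {π : List Part} (sorted : Sorted π) where

    -- A window at an arbitrary `p₀` is controlled by its first member `p`: since `p` is at most
    -- `p₀`, also `rise p ≤ rise p₀`, and whatever is close to `p₀` is close to `p`. A member at
    -- distance `n` from `p` would therefore contradict `Far`.
    far⇒window≤ : ∀ n → (∀ i p q → nth π i ≡ just p → nth π (i + n) ≡ just q → Far p q) →
      ∀ p₀ → cnt (Win? p₀) π ≤ n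
    far⇒window≤ n cond p₀ = ≮⇒≥ λ n<cnt →
      let dec = decompose p₀ sorted
          open Decomposition dec
          n<W = subst (n <_) (cong length (filter-Win dec)) n<cnt
          p , eqp = nth-just W {0} (≤-<-trans z≤n n<W)
          q , eqq = nth-just W n<W
          far = far⇒ p q (cond (length U + 0) p q (trans (nth-W dec (≤-<-trans z≤n n<W)) eqp)
                  (trans (cong (λ j → nth π (j + n)) (+-identityʳ (length U))) (trans (nth-W dec n<W) eqq)))
      in <⇒≱ far (≤-trans (code≤⇒rise≤ p p₀ (proj₁ (nth-All 0 within eqp))) (proj₂ (nth-All n within eqq)))

    window≤⇒far : ∀ n i p q → cnt (Win? p) π ≤ n → nth π i ≡ just p → nth π (i + n) ≡ just q → Far p q
    window≤⇒far n i p q few eqp eqq = far⇐ p q (≰⇒> λ near →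
      let dec = decompose p sorted
          open Decomposition dec
          W≤n = subst (_≤ n) (cong length (filter-Win dec)) few
      in <⇒≱ (index<UW dec (i + n) eqq near)
             (+-mono-≤ (U≤index dec i eqp ≤-refl) W≤n))

    -- When the window below p₀ holds exactly suc n parts, it is the block of cond5 starting at its first part.
    block⇒window : ∀ n (Q : List Part → Part → Set) →
      (∀ i p q → nth π i ≡ just p → nth π (i + n) ≡ just q → Near p q → Q (take (suc n) (drop i π)) p) →
      ∀ p₀ → cnt (Win? p₀) π ≡ suc n →
      ∃ λ p → Q (filter (Win? p₀) π) p × All (λ q → (code q ≤ code p → code q ≤ code p₀) × (code q ≤ code p₀ → code q ≤ code p)) π
    block⇒window n Q cond p₀ eq = p , subst (λ ws → Q ws p) block (cond (length U + 0) p q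
        (trans (nth-W dec 0<W) eqp)
        (trans (cong (λ j → nth π (j + n)) (+-identityʳ (length U))) (trans (nth-W dec n<W) eqq))
        (near⇐ p q (≤-trans (code≤⇒rise≤ p p₀ p≤p₀) (proj₂ (nth-All n within eqq))))) , same
      where
      dec = decompose p₀ sorted
      open Decomposition dec
      lenW : length W ≡ suc n
      lenW = trans (sym (cong length (filter-Win dec))) eq
      n<W : n < length W
      n<W = ≤-reflexive (sym lenW)
      0<W = ≤-<-trans z≤n n<W
      hd = nth-just W {0} 0<W
      lst = nth-just W n<W
      p = proj₁ hd
      eqp = proj₂ hd
      q = proj₁ lst
      eqq = proj₂ lst
      p≤p₀ : code p ≤ code p₀
      p≤p₀ = proj₁ (nth-All 0 within eqp)
      block : take (suc n) (drop (length U + 0) π) ≡ filter (Win? p₀) π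
      block = block-W dec (+-identityʳ (length U)) lenW
      sortedWZ : ∀ V → Sorted (V ++ (W ++ Z)) → Sorted (W ++ Z)
      sortedWZ []      s       = s
      sortedWZ (_ ∷ V) (_ ∷ s) = sortedWZ V s
      head-max : ∀ {xs} → Sorted xs → nth xs 0 ≡ just p → All (λ q → code q ≤ code p) xs
      head-max (h ∷ _) refl = ≤-refl ∷ h
      tail≤p : All (λ q → code q ≤ code p) (W ++ Z)
      tail≤p = head-max (sortedWZ U (subst Sorted glue sorted)) (trans (nth-++ˡ W Z 0<W) eqp)
      -- No part lies above `p` and at or below `p₀`, so `Vbar` takes the same value at the actual
      -- head and at the threshold.
      same : All (λ q → (code q ≤ code p → code q ≤ code p₀) × (code q ≤ code p₀ → code q ≤ code p)) π
      same = subst (All _) (sym glue) (All.++⁺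
        (All.map (λ lt → (λ le → ≤-trans le p≤p₀) , λ le → ⊥-elim (<⇒≱ lt le)) above)
        (All.map (λ le → (λ _ → ≤-trans le p≤p₀) , λ _ → le) tail≤p))

    -- Position count: `length U ≤ i`, while `i + n < length U + length W ≤ length U + suc
    -- n`. This leaves room only for `i = length U` and a window with exactly `suc n` members.
    window⇒block : ∀ n i p q → cnt (Win? p) π ≤ suc n → nth π i ≡ just p → nth π (i + n) ≡ just q → Near p q →
      cnt (Win? p) π ≡ suc n × take (suc n) (drop i π) ≡ filter (Win? p) π
    window⇒block n i p q few eqp eqq nr = trans (cong length (filter-Win dec)) lenW , block
      where
      dec = decompose p sorted
      open Decomposition dec
      W≤ : length W ≤ suc n
      W≤ = subst (_≤ suc n) (cong length (filter-Win dec)) few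
      U≤i : length U ≤ i
      U≤i = U≤index dec i eqp ≤-refl
      i+n< : i + n < length U + length W
      i+n< = index<UW dec (i + n) eqq (near⇒ p q nr)
      i≡U : i ≡ length U
      i≡U = ≤-antisym (+-cancelʳ-≤ (suc n) i (length U) (≤-trans (≤-reflexive (+-suc i n)) (≤-trans i+n< (+-monoʳ-≤ (length U) W≤)))) U≤i
      lenW : length W ≡ suc n
      lenW = ≤-antisym W≤ (+-cancelˡ-≤ (length U) (suc n) (length W)
        (≤-trans (≤-reflexive (+-suc (length U) n)) (subst (λ j → j + n < length U + length W) i≡U i+n<)))
      block : take (suc n) (drop i π) ≡ filter (Win? p) π
      block = block-W dec i≡U lenW

-- Parity and levels

parity-+ : ∀ m n → parity (m + n) ≡ parity m ℙ.+ parity n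
parity-+ = ℙ.+-homo-+

parity-even : ∀ n x → parity (x + 2 * n) ≡ parity x
parity-even n x = trans (parity-+ x (2 * n)) (trans (cong (parity x ℙ.+_) (ℙ.*-homo-* 2 n)) (ℙ.+-identityʳ (parity x)))

pbit : Parity → ℕ
pbit 0ℙ = 0
pbit 1ℙ = 1

∣⇒parity≡0 : ∀ {n} → 2 ∣ n → parity n ≡ 0ℙ
∣⇒parity≡0 (divides q refl) = trans (cong parity (*-comm q 2)) (parity-even q 0)

parity≡0⇒∣ : ∀ n → parity n ≡ 0ℙ → 2 ∣ n
parity≡0⇒∣ zero          _  = divides 0 refl
parity≡0⇒∣ (suc (suc n)) eq = ∣m∣n⇒∣m+n (divides 1 refl) (parity≡0⇒∣ n eq)

-- Subtraction and addition agree modulo 2. This moves the integer congruence of condition (5) to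
-- the parity of a sum of naturals.
parity-∣-∣ : ∀ m n → parity ℤ.∣ m ⊖ n ∣ ≡ parity (m + n)
parity-∣-∣ m n with ≤-total n m
... | inj₁ n≤m = begin
  parity ℤ.∣ m ⊖ n ∣           ≡⟨ cong parity (trans (cong ℤ.∣_∣ (ℤ.⊖-≥ n≤m)) refl) ⟩
  parity (m ∸ n)               ≡⟨ parity-even n (m ∸ n) ⟨
  parity (m ∸ n + (n + (n + 0))) ≡⟨ cong parity (trans (sym (+-assoc (m ∸ n) n _)) (cong₂ _+_ (m∸n+n≡m n≤m) (+-identityʳ n))) ⟩
  parity (m + n) ∎
  where open ≡-Reasoning
... | inj₂ m≤n = begin
  parity ℤ.∣ m ⊖ n ∣           ≡⟨ cong parity (ℤ.∣⊖∣-≤ m≤n) ⟩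
  parity (n ∸ m)               ≡⟨ parity-even m (n ∸ m) ⟨
  parity (n ∸ m + (m + (m + 0))) ≡⟨ cong parity (trans (sym (+-assoc (n ∸ m) m _)) (cong₂ _+_ (m∸n+n≡m m≤n) (+-identityʳ m))) ⟩
  parity (n + m)               ≡⟨ cong parity (+-comm n m) ⟩
  parity (m + n) ∎
  where open ≡-Reasoning

congMod2⇒parity : ∀ a b → CongMod 2 a b → parity (a + b) ≡ 0ℙ
congMod2⇒parity a b h = trans (sym (parity-∣-∣ a b)) (∣⇒parity≡0 (subst (2 ∣_) (cong ℤ.∣_∣ (ℤ.m-n≡m⊖n a b)) h))

parity⇒congMod2 : ∀ a b → parity (a + b) ≡ 0ℙ → CongMod 2 a b
parity⇒congMod2 a b h = subst (2 ∣_) (cong ℤ.∣_∣ (sym (ℤ.m-n≡m⊖n a b))) (parity≡0⇒∣ _ (trans (parity-∣-∣ a b) h))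

countWhere≡cnt : {P : Part → Set} (P? : Decidable P) (f : Part → Bool) → (∀ x → f x ≡ does (P? x)) →
  ∀ xs → countWhere f xs ≡ cnt P? xs
countWhere≡cnt P? f eq []       = refl
countWhere≡cnt P? f eq (x ∷ xs) rewrite eq x with P? x
... | yes _ = cong suc (countWhere≡cnt P? f eq xs)
... | no  _ = countWhere≡cnt P? f eq xs

decide≤≡does : ∀ m n → decide≤ m n ≡ does (m ≤? n)
decide≤≡does m n with m ≤? n in eq
... | yes _ = cong does (sym eq)
... | no  _ = cong does (sym eq)

OverBelow? : ∀ p → Decidable (λ q → over q ≡ true × code q ≤ code p)
OverBelow? p q = (over q ≟ᵇ true) ×-dec (code q ≤? code p)

Vbar≡cnt : ∀ π p → Vbar π p ≡ cnt (OverBelow? p) π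
Vbar≡cnt π p = countWhere≡cnt (OverBelow? p) _ eq π
  where
  eq : ∀ q → (if over q then decide≤ (code q) (code p) else false) ≡ does (OverBelow? p q)
  eq q@(part _ true)  = decide≤≡does (code q) (code p)
  eq   (part _ false) = refl

Is? : ∀ s o → Decidable (λ q → size q ≡ s × over q ≡ o)
Is? s o q = (size q ≟ s) ×-dec (over q ≟ᵇ o)

mult : List Part → ℕ → Bool → ℕ
mult π s o = cnt (Is? s o) π

cntKey≡mult : ∀ π s → cntKey size π s ≡ mult π s false + mult π s true
cntKey≡mult π s = cnt-⊎ (λ q → size q ≟ s) (Is? s false) (Is? s true) π (All.tabulate λ {q} _ → to q ,
    (λ (eq , f) → eq , λ (_ , t) → true≢false (trans (sym t) f)) , proj₁)
  where
  true≢false : true ≢ false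
  true≢false ()
  to : ∀ q → size q ≡ s → (size q ≡ s × over q ≡ false) ⊎ (size q ≡ s × over q ≡ true)
  to q eq with over q
  ... | true  = inj₂ (eq , refl)
  ... | false = inj₁ (eq , refl)

-- Windows and overline counts split by multiples of η

module Levels (η : ℕ) .{{_ : NonZero η}} where

  open Windows η public

  0<η : 0 < η
  0<η = >-nonZero⁻¹ η

  At Plain Over : ℕ → Part → Set
  At m q    = size q ≡ m * η
  Plain m q = size q ≡ m * η × over q ≡ false
  Over m q  = size q ≡ m * η × over q ≡ true

  NonIn Range OverIn : ℕ → ℕ → Part → Set
  NonIn l h q  = ¬ (η ∣ size q) × l ≤ size q × size q < h
  Range l h q  = l ≤ size q × size q < h
  OverIn l h q = over q ≡ true × l ≤ size q × size q < h

  NonInSize? : ∀ l h → Decidable (λ s → ¬ (η ∣ s) × l ≤ s × s < h)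
  NonInSize? l h s = ¬? (η ∣? s) ×-dec ((l ≤? s) ×-dec (s <? h))

  At? : ∀ m → Decidable (At m)
  At? m q = size q ≟ m * η

  Plain? : ∀ m → Decidable (Plain m)
  Plain? m q = (size q ≟ m * η) ×-dec (over q ≟ᵇ false)

  Over? : ∀ m → Decidable (Over m)
  Over? m q = (size q ≟ m * η) ×-dec (over q ≟ᵇ true)

  NonIn? : ∀ l h → Decidable (NonIn l h)
  NonIn? l h q = NonInSize? l h (size q)

  Range? : ∀ l h → Decidable (Range l h)
  Range? l h q = (l ≤? size q) ×-dec (size q <? h)

  OverIn? : ∀ l h → Decidable (OverIn l h)
  OverIn? l h q = (over q ≟ᵇ true) ×-dec ((l ≤? size q) ×-dec (size q <? h))

  level-unique : ∀ m j {s} → m * η ≤ s → s < η + m * η → j * η ≤ s → s < η + j * η → j ≡ m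
  level-unique m j m≤ <m j≤ <j = ≤-antisym
    (s≤s⁻¹ (*-cancelʳ-< η j (suc m) (≤-<-trans j≤ <m)))
    (s≤s⁻¹ (*-cancelʳ-< η m (suc j) (≤-<-trans m≤ <j)))

  floor-level : ∀ m {s} → m * η ≤ s → s < η + m * η → s / η ≡ m
  floor-level m {s} m≤ <m = ≤-antisym (s≤s⁻¹ (m<n*o⇒m/o<n {s} {suc m} {η} <m))
    (subst (_≤ s / η) (m*n/n≡m m η) (/-mono-≤ m≤ (≤-refl {η})))

  in-level : ∀ s → s / η * η ≤ s × s < η + s / η * η
  in-level s = m/n*n≤m s η , subst (_< η + s / η * η) (sym (m≡m%n+[m/n]*n s η)) (+-monoˡ-< (s / η * η) (m%n<n s η))

  -- In a level, the only multiple of η is its lower end.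
  range-split : ∀ m {h} → m * η < h → h ≤ η + m * η → ∀ q →
    (Range (m * η) h q → At m q ⊎ NonIn (m * η) h q) ×
    (At m q → Range (m * η) h q × ¬ NonIn (m * η) h q) ×
    (NonIn (m * η) h q → Range (m * η) h q)
  range-split m {h} m<h h≤ q = to , from , proj₂
    where
    to : Range (m * η) h q → At m q ⊎ NonIn (m * η) h q
    to (l≤ , <h) with η ∣? size q
    ... | no ¬d            = inj₂ (¬d , l≤ , <h)
    ... | yes (divides j eq) = inj₁ (trans eq (cong (_* η) (level-unique m j l≤ (<-≤-trans <h h≤)
            (≤-reflexive (sym eq)) (subst (λ x → size q < η + x) eq (m<n+m (size q) 0<η)))))
    from : At m q → Range (m * η) h q × ¬ NonIn (m * η) h q
    from eq = (≤-reflexive (sym eq) , subst (_< h) (sym eq) m<h) , λ (¬d , _) → ¬d (divides m eq)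

  -- The sizes from `suc s ∸ η` to `s` are at most η consecutive integers, so `m * η` is the only
  -- multiple of η among them. The truncation for `s < η` is harmless: the window then reaches down
  -- to size 0.
  over-window : ∀ m {s} → m * η ≤ s → s < η + m * η → ∀ q →
    (Win (part s true) q → At m q ⊎ NonIn (suc s ∸ η) (suc s) q) ×
    (At m q → Win (part s true) q × ¬ NonIn (suc s ∸ η) (suc s) q) ×
    (NonIn (suc s ∸ η) (suc s) q → Win (part s true) q)
  over-window m {s} m≤ <m q = to , from , back
    where
    lower⇒ : s + 1 ≤ size q + η → suc s ∸ η ≤ size q
    lower⇒ le = m≤n+o⇒m∸n≤o (suc s) η (subst₂ _≤_ (+-comm s 1) (+-comm (size q) η) le)
    lower⇐ : suc s ∸ η ≤ size q → s + 1 ≤ size q + η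
    lower⇐ le = subst₂ _≤_ (+-comm 1 s) (+-comm η (size q)) (≤-trans (m≤n+m∸n (suc s) η) (+-monoʳ-≤ η le))
    to : Win (part s true) q → At m q ⊎ NonIn (suc s ∸ η) (suc s) q
    to (c≤ , r≤) with η ∣? size q
    ... | no ¬d            = inj₂ (¬d , lower⇒ r≤ , s≤s (code≤over⁻ q c≤))
    ... | yes (divides j eq) = inj₁ (trans eq (cong (_* η) (level-unique m j m≤ <m
            (subst (_≤ s) eq (code≤over⁻ q c≤))
            (subst (λ x → s < η + x) eq (subst₂ _≤_ (+-comm s 1) (+-comm (size q) η) r≤)))))
    from : At m q → Win (part s true) q × ¬ NonIn (suc s ∸ η) (suc s) q
    from eq = (code≤over⁺ q (subst (_≤ s) (sym eq) m≤) ,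
               subst₂ _≤_ (+-comm 1 s) (trans (cong (η +_) (sym eq)) (+-comm η (size q))) <m) ,
              λ (¬d , _) → ¬d (divides m eq)
    back : NonIn (suc s ∸ η) (suc s) q → Win (part s true) q
    back (_ , l≤ , <h) = code≤over⁺ q (s≤s⁻¹ <h) , lower⇐ l≤

  -- The overlined part of size `suc m * η` lies above the plain one, so only plain copies enter at
  -- the top, whereas the lower end `m * η` is included with either kind. This window can therefore
  -- meet two levels.
  plain-window : ∀ m q →
    (Win (plain (suc m * η)) q → Plain (suc m) q ⊎ Range (m * η) (suc m * η) q) ×
    (Plain (suc m) q → Win (plain (suc m * η)) q × ¬ Range (m * η) (suc m * η) q) ×
    (Range (m * η) (suc m * η) q → Win (plain (suc m * η)) q)
  plain-window m q = to , from , back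
    where
    to : Win (plain (suc m * η)) q → Plain (suc m) q ⊎ Range (m * η) (suc m * η) q
    to (c≤ , r≤) with code≤plain⁻ q c≤
    ... | inj₂ pl = inj₁ pl
    ... | inj₁ lt = inj₂ (+-cancelˡ-≤ η (m * η) (size q) (subst₂ _≤_ (+-identityʳ (suc m * η)) (+-comm (size q) η) r≤) , lt)
    from : Plain (suc m) q → Win (plain (suc m * η)) q × ¬ Range (m * η) (suc m * η) q
    from (eq , ov) = (≤-reflexive (cong₂ (λ x o → code (part x o)) eq ov) ,
      subst (_≤ size q + η) (trans eq (sym (+-identityʳ (suc m * η)))) (m≤m+n (size q) η)) ,
      λ (_ , lt) → <-irrefl eq lt
    back : Range (m * η) (suc m * η) q → Win (plain (suc m * η)) q
    back (l≤ , <h) = <⇒≤ (code<plain⁺ q <h) ,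
      subst₂ _≤_ (sym (+-identityʳ (suc m * η))) (+-comm η (size q)) (+-monoʳ-≤ η l≤)

  module _ (π : List Part) where

    a b V : ℕ → ℕ
    a m = cnt (Plain? m) π
    b m = cnt (Over? m) π
    V m = cnt (OverIn? 0 (m * η)) π

    e : ℕ → ℕ → ℕ
    e l h = cnt (NonIn? l h) π

    X E : ℕ → ℕ
    X s = e (suc s ∸ η) (suc s)
    E m = e (m * η) (suc m * η)

  Shape : Part → Set
  Shape q = 1 ≤ size q × (over q ≡ false → η ∣ size q)

  nonmultiple-over : ∀ q → Shape q → ¬ (η ∣ size q) → over q ≡ true
  nonmultiple-over q (_ , f) ¬d with over q
  ... | true  = refl
  ... | false = ⊥-elim (¬d (f refl))

  cnt-Range : ∀ π m {h} → m * η < h → h ≤ η + m * η → cnt (Range? (m * η) h) π ≡ a π m + b π m + e π (m * η) h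
  cnt-Range π m {h} m<h h≤ = trans
    (cnt-⊎ (Range? (m * η) h) (At? m) (NonIn? (m * η) h) π (All.tabulate λ {q} _ → range-split m m<h h≤ q))
    (cong (_+ e π (m * η) h) (cntKey≡mult π (m * η)))

  cnt-over-window : ∀ π m {s} → m * η ≤ s → s < η + m * η → cnt (Win? (part s true)) π ≡ a π m + b π m + X π s
  cnt-over-window π m {s} m≤ <m = trans
    (cnt-⊎ (Win? (part s true)) (At? m) (NonIn? (suc s ∸ η) (suc s)) π (All.tabulate λ {q} _ → over-window m m≤ <m q))
    (cong (_+ X π s) (cntKey≡mult π (m * η)))

  m<sucm : ∀ m → m * η < suc m * η
  m<sucm m = m<n+m (m * η) 0<η

  cnt-plain-window : ∀ π m → cnt (Win? (plain (suc m * η))) π ≡ a π (suc m) + (a π m + b π m + E π m)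
  cnt-plain-window π m = trans
    (cnt-⊎ (Win? (plain (suc m * η))) (Plain? (suc m)) (Range? (m * η) (suc m * η)) π (All.tabulate λ {q} _ → plain-window m q))
    (cong (a π (suc m) +_) (cnt-Range π m (m<sucm m) ≤-refl))

  module _ {π : List Part} (shape : All Shape π) where

    cnt-OverIn : ∀ m {h} → m * η < h → h ≤ η + m * η → cnt (OverIn? (m * η) h) π ≡ b π m + e π (m * η) h
    cnt-OverIn m {h} m<h h≤ = cnt-⊎ (OverIn? (m * η) h) (Over? m) (NonIn? (m * η) h) π (All.map (λ {q} → split q) shape)
      where
      split : ∀ q → Shape q → (OverIn (m * η) h q → Over m q ⊎ NonIn (m * η) h q) ×
        (Over m q → OverIn (m * η) h q × ¬ NonIn (m * η) h q) × (NonIn (m * η) h q → OverIn (m * η) h q)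
      split q sh = to , (λ (eq , t) → (t , proj₁ (from eq)) , proj₂ (from eq)) ,
                   λ ni → nonmultiple-over q sh (proj₁ ni) , proj₂ ni
        where
        from = proj₁ (proj₂ (range-split m m<h h≤ q))
        to : OverIn (m * η) h q → Over m q ⊎ NonIn (m * η) h q
        to (t , rg) with proj₁ (range-split m m<h h≤ q) rg
        ... | inj₁ eq = inj₁ (eq , t)
        ... | inj₂ ni = inj₂ ni

    OverIn-split : ∀ m {h} → m * η ≤ h → cnt (OverIn? 0 h) π ≡ V π m + cnt (OverIn? (m * η) h) π
    OverIn-split m {h} m≤h = cnt-⊎ (OverIn? 0 h) (OverIn? 0 (m * η)) (OverIn? (m * η) h) π
      (All.tabulate λ {q} _ → to q , (λ (t , z , lt) → (t , z , <-≤-trans lt m≤h) , λ (_ , ge , _) → <⇒≱ lt ge) ,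
        λ (t , _ , lt) → t , z≤n , lt)
      where
      to : ∀ q → OverIn 0 h q → OverIn 0 (m * η) q ⊎ OverIn (m * η) h q
      to q (t , z , lt) with m * η ≤? size q
      ... | yes ge = inj₂ (t , ge , lt)
      ... | no ¬ge = inj₁ (t , z , ≰⇒> ¬ge)

    V-suc : ∀ m → V π (suc m) ≡ V π m + (b π m + E π m)
    V-suc m = trans (OverIn-split m (<⇒≤ (m<sucm m))) (cong (V π m +_) (cnt-OverIn m (m<sucm m) ≤-refl))

    V-over : ∀ m {s} → m * η ≤ s → s < η + m * η → Vbar π (part s true) ≡ V π m + (b π m + e π (m * η) (suc s))
    V-over m {s} m≤ <m = begin
      Vbar π (part s true)                     ≡⟨ Vbar≡cnt π (part s true) ⟩
      cnt (OverBelow? (part s true)) π         ≡⟨ cnt-cong (OverBelow? (part s true)) (OverIn? 0 (suc s)) π (All.tabulate λ {q} _ →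
                                                    (λ (t , c) → t , z≤n , s≤s (code≤over⁻ q c)) ,
                                                    (λ (t , _ , lt) → t , code≤over⁺ q (s≤s⁻¹ lt))) ⟩
      cnt (OverIn? 0 (suc s)) π                ≡⟨ OverIn-split m (m≤n⇒m≤1+n m≤) ⟩
      V π m + cnt (OverIn? (m * η) (suc s)) π  ≡⟨ cong (V π m +_) (cnt-OverIn m (s≤s m≤) <m) ⟩
      V π m + (b π m + e π (m * η) (suc s))    ∎
      where open ≡-Reasoning

    V-plain : ∀ m → Vbar π (plain (m * η)) ≡ V π m
    V-plain m = trans (Vbar≡cnt π (plain (m * η))) (cnt-cong (OverBelow? (plain (m * η))) (OverIn? 0 (m * η)) π
      (All.tabulate λ {q} _ → (λ (t , c) → t , z≤n , to q t c) , (λ (t , _ , lt) → t , <⇒≤ (code<plain⁺ q lt))))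
      where
      to : ∀ q → over q ≡ true → code q ≤ code (plain (m * η)) → size q < m * η
      to q t c with code≤plain⁻ q c
      ... | inj₁ lt      = lt
      ... | inj₂ (_ , f) with () ← trans (sym t) f

    a0≡0 : a π 0 ≡ 0
    a0≡0 = cnt-none (Plain? 0) (All.map (λ { (s≤s _ , _) (() , _) }) shape)

    b0≡0 : b π 0 ≡ 0
    b0≡0 = cnt-none (Over? 0) (All.map (λ { (s≤s _ , _) (() , _) }) shape)

  module _ {P : Part → Set} (P? : Decidable P) where

    Upper? : ∀ m → Decidable (λ q → P q × m * η ≤ size q)
    Upper? m q = P? q ×-dec (m * η ≤? size q)

    -- The hypothesis confines the selected parts to two consecutive levels, so each floor is `m` or
    -- one less. Adding the number of parts to the sum avoids the predecessor of `m`, which would be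
    -- wrong at `m = 0`.
    sum-floors : ∀ m π → All (λ q → P q → m * η ≤ size q + η × size q < η + m * η) π →
      sum (map (fl η) (filter P? π)) + cnt P? π ≡ m * cnt P? π + cnt (Upper? m) π
    sum-floors m []      [] = sym (trans (+-identityʳ (m * 0)) (*-zeroʳ m))
    sum-floors m (q ∷ π) (h ∷ hs) = step (P? q) (m * η ≤? size q)
      where
      open ≡-Reasoning
      S = sum (map (fl η) (filter P? π))
      c = cnt P? π
      w = cnt (Upper? m) π
      floor-below : ∀ m → ¬ (m * η ≤ size q) → m * η ≤ size q + η → suc (fl η q) ≡ m
      floor-below zero    ¬ge _  = ⊥-elim (¬ge z≤n)
      floor-below (suc m) ¬ge le = cong suc (floor-level m
        (+-cancelˡ-≤ η (m * η) (size q) (subst (suc m * η ≤_) (+-comm (size q) η) le)) (≰⇒> ¬ge))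
      shuffle₁ : ∀ f S c → f + S + suc c ≡ suc f + (S + c)
      shuffle₁ = solve-∀
      shuffle₂ : ∀ m c w → suc m + (m * c + w) ≡ m * suc c + suc w
      shuffle₂ = solve-∀
      shuffle₃ : ∀ m c w → m + (m * c + w) ≡ m * suc c + w
      shuffle₃ = solve-∀
      step : Dec (P q) → Dec (m * η ≤ size q) →
        sum (map (fl η) (filter P? (q ∷ π))) + cnt P? (q ∷ π) ≡ m * cnt P? (q ∷ π) + cnt (Upper? m) (q ∷ π)
      step (no ¬pq) _ rewrite filter-reject P? {xs = π} ¬pq | filter-reject (Upper? m) {x = q} {xs = π} (¬pq ∘ proj₁) =
        sum-floors m π hs
      step (yes pq) (yes ge) rewrite filter-accept P? {xs = π} pq | filter-accept (Upper? m) {xs = π} (pq , ge) = begin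
        fl η q + S + suc c     ≡⟨ shuffle₁ (fl η q) S c ⟩
        suc (fl η q) + (S + c) ≡⟨ cong₂ (λ x y → suc x + y) (floor-level m ge (proj₂ (h pq))) (sum-floors m π hs) ⟩
        suc m + (m * c + w)    ≡⟨ shuffle₂ m c w ⟩
        m * suc c + suc w      ∎
      step (yes pq) (no ¬ge) rewrite filter-accept P? {xs = π} pq | filter-reject (Upper? m) {x = q} {xs = π} (¬ge ∘ proj₂) = begin
        fl η q + S + suc c     ≡⟨ shuffle₁ (fl η q) S c ⟩
        suc (fl η q) + (S + c) ≡⟨ cong₂ _+_ (floor-below m ¬ge (proj₁ (h pq))) (sum-floors m π hs) ⟩
        m + (m * c + w)        ≡⟨ shuffle₃ m c w ⟩
        m * suc c + w          ∎

-- Strictness at a single parity: "x ≤ C, and x = C only if δ is even" is one inequality.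
tight⇒ : ∀ {x C} δ → x ≤ C → (x ≡ C → δ ≡ 0ℙ) → x + pbit δ ≤ C
tight⇒ {x} {C} 0ℙ x≤C _ = subst (_≤ C) (sym (+-identityʳ x)) x≤C
tight⇒ {x} {C} 1ℙ x≤C h = subst (_≤ C) (+-comm 1 x) (≤∧≢⇒< x≤C λ eq → 1≢0 (h eq))
  where
  1≢0 : 1ℙ ≢ 0ℙ
  1≢0 ()

tight⇐ : ∀ {x C} δ → x + pbit δ ≤ C → x ≡ C → δ ≡ 0ℙ
tight⇐ 0ℙ _  _    = refl
tight⇐ {x} 1ℙ le refl = ⊥-elim (<-irrefl refl (subst (_≤ x) (+-comm x 1) le))

-- `t` stands for the overlined parts of the window at its upper level: each adds one to the floor
-- sum and one to the overline count, and so disappears modulo 2. What is left depends on the level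
-- but not on the position of the window within it, which is why a single parity per level suffices.
-- The count `C` needed to express the floor sum turns `M * C` into `suc M * C`.
parity-shift : ∀ S C M a t R v → S + C ≡ M * C + (a + t) →
  parity (S + 1 + (R + (v + t))) ≡ parity (a + suc (R + v + suc M * C))
parity-shift S C M a t R v eq = begin
  parity (S + 1 + (R + (v + t)))           ≡⟨ parity-even C (S + 1 + (R + (v + t))) ⟨
  parity (S + 1 + (R + (v + t)) + 2 * C)   ≡⟨ cong parity (shuffle₁ S C R v t) ⟩
  parity (S + C + (1 + R + v + t + C))     ≡⟨ cong (λ x → parity (x + (1 + R + v + t + C))) eq ⟩
  parity (M * C + (a + t) + (1 + R + v + t + C)) ≡⟨ cong parity (shuffle₂ M C a t R v) ⟩
  parity (a + suc (R + v + suc M * C) + 2 * t)   ≡⟨ parity-even t (a + suc (R + v + suc M * C)) ⟩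
  parity (a + suc (R + v + suc M * C))     ∎
  where
  open ≡-Reasoning
  shuffle₁ : ∀ S C R v t → S + 1 + (R + (v + t)) + 2 * C ≡ S + C + (1 + R + v + t + C)
  shuffle₁ = solve-∀
  shuffle₂ : ∀ M C a t R v → M * C + (a + t) + (1 + R + v + t + C) ≡ a + suc (R + v + suc M * C) + 2 * t
  shuffle₂ = solve-∀

-- Membership conditions as inequalities between multiplicities

module Conditions (η : ℕ) .{{_ : NonZero η}} where

  open Levels η public

  -- The parity of a_m - P_m, where R is the parameter of B̄₀ and C = k - 1.
  defect : ℕ → ℕ → List Part → ℕ → Parity
  defect R C π m = parity (a π m + suc (R + V π m + suc m * C))

  -- `around` covers the windows at overlined thresholds, `between` those at plain multiples of η,
  -- and `lowest` is condition (4). The slack `u` is 0 when condition (5) is vacuous (j = 1) and the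
  -- bit of `defect` for j = 0, where it merges conditions (3) and (5).
  record LevelBounds (C R : ℕ) (u : ℕ → ℕ) (π : List Part) : Set where
    field
      around  : ∀ m s → m * η ≤ s → s < η + m * η → a π m + b π m + X π s + u m ≤ C
      between : ∀ m → a π (suc m) + (a π m + b π m + E π m) + u (suc m) ≤ C
      lowest  : a π 1 + E π 0 + 1 ≤ R

  BlockParity : ℕ → List Part → Part → Set
  BlockParity R π p = parity (sum (map (fl η) (filter (Win? p) π)) + 1 + (R + Vbar π p)) ≡ 0ℙ

  Shape⇐ : ∀ {π} → All (λ p → 1 ≤ size p) π → All (λ p → over p ≡ false → η ∣ size p) π → All Shape π
  Shape⇐ pos c2 = All.zipWith (λ x → x) (pos , c2)

  module _ {π : List Part} (shape : All Shape π) where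

    over-parity : ∀ R m {s} → m * η ≤ s → s < η + m * η → ∀ {C} → cnt (Win? (part s true)) π ≡ C →
      parity (sum (map (fl η) (filter (Win? (part s true)) π)) + 1 + (R + Vbar π (part s true))) ≡ defect R C π m
    over-parity R m {s} m≤ <m {C} refl
      rewrite V-over shape m m≤ <m =
      parity-shift (sum (map (fl η) (filter (Win? p) π))) C m (a π m) (b π m + e π (m * η) (suc s)) R (V π m) (begin
        sum (map (fl η) (filter (Win? p) π)) + C   ≡⟨ sum-floors (Win? p) m π (All.tabulate λ {q} _ (c≤ , r≤) →
                                                         ≤-trans m≤ (≤-trans (m≤m+n s 1) r≤) , ≤-<-trans (code≤over⁻ q c≤) <m) ⟩
        m * C + cnt (Upper? (Win? p) m) π          ≡⟨ cong (m * C +_) (cnt-⊎ (Upper? (Win? p) m) (At? m) (NonIn? (m * η) (suc s)) π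
                                                         (All.tabulate λ {q} _ → split q)) ⟩
        m * C + (cnt (At? m) π + e π (m * η) (suc s)) ≡⟨ cong (λ x → m * C + (x + e π (m * η) (suc s))) (cntKey≡mult π (m * η)) ⟩
        m * C + (a π m + b π m + e π (m * η) (suc s)) ≡⟨ cong (m * C +_) (+-assoc (a π m) (b π m) _) ⟩
        m * C + (a π m + (b π m + e π (m * η) (suc s))) ∎)
      where
      open ≡-Reasoning
      p = part s true
      split : ∀ q → (Win p q × m * η ≤ size q → At m q ⊎ NonIn (m * η) (suc s) q) ×
        (At m q → (Win p q × m * η ≤ size q) × ¬ NonIn (m * η) (suc s) q) ×
        (NonIn (m * η) (suc s) q → Win p q × m * η ≤ size q)
      split q with over-window m m≤ <m q | range-split m (s≤s m≤) <m q
      ... | _ , winAt , _ | to , from , _ =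
        (λ ((c≤ , _) , ge) → to (ge , s≤s (code≤over⁻ q c≤))) ,
        (λ eq → (proj₁ (winAt eq) , ≤-reflexive (sym eq)) , proj₂ (from eq)) ,
        (λ (¬d , ge , lt) → (code≤over⁺ q (s≤s⁻¹ lt) ,
            subst₂ _≤_ (+-comm 1 s) (+-comm η (size q)) (≤-trans <m (+-monoʳ-≤ η ge))) , ge)

    -- Here `t` is 0 in `parity-shift`: the overlined parts of the window lie below `suc m * η`, so
    -- they have the smaller floor, and all overlined parts counted by `Vbar` are already in
    -- `V (suc m)`.
    plain-parity : ∀ R m {C} → cnt (Win? (plain (suc m * η))) π ≡ C →
      parity (sum (map (fl η) (filter (Win? (plain (suc m * η))) π)) + 1 + (R + Vbar π (plain (suc m * η)))) ≡ defect R C π (suc m)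
    plain-parity R m {C} refl rewrite V-plain shape (suc m) =
      trans (cong (λ x → parity (sum (map (fl η) (filter (Win? p) π)) + 1 + (R + x))) (sym (+-identityʳ (V π (suc m)))))
      (parity-shift (sum (map (fl η) (filter (Win? p) π))) C (suc m) (a π (suc m)) 0 R (V π (suc m)) (begin
        sum (map (fl η) (filter (Win? p) π)) + C   ≡⟨ sum-floors (Win? p) (suc m) π (All.tabulate λ {q} _ (c≤ , r≤) →
                                                         subst (_≤ size q + η) (+-identityʳ _) r≤ ,
                                                         ≤-<-trans (code≤⇒size≤ q p c≤) (m<sucm (suc m))) ⟩
        suc m * C + cnt (Upper? (Win? p) (suc m)) π ≡⟨ cong (suc m * C +_) (cnt-cong (Upper? (Win? p) (suc m)) (Plain? (suc m)) π
                                                         (All.tabulate λ {q} _ → to q , (λ pl → proj₁ (proj₁ (proj₂ (plain-window m q)) pl) ,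
                                                            ≤-reflexive (sym (proj₁ pl))))) ⟩
        suc m * C + a π (suc m)                    ≡⟨ cong (suc m * C +_) (+-identityʳ _) ⟨
        suc m * C + (a π (suc m) + 0)              ∎))
      where
      open ≡-Reasoning
      p = plain (suc m * η)
      to : ∀ q → Win p q × suc m * η ≤ size q → Plain (suc m) q
      to q (w , ge) with proj₁ (plain-window m q) w
      ... | inj₁ pl       = pl
      ... | inj₂ (_ , lt) = ⊥-elim (<⇒≱ lt ge)

    cond4-count : countWhere (λ p → decide≤ (code p) (code (plain η))) π ≡ a π 1 + E π 0
    cond4-count = begin
      countWhere (λ p → decide≤ (code p) (code (plain η))) π
        ≡⟨ countWhere≡cnt (λ p → code p ≤? code (plain η)) _ (λ p → decide≤≡does (code p) (code (plain η))) π ⟩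
      cnt (λ p → code p ≤? code (plain η)) π
        ≡⟨ cnt-cong (λ p → code p ≤? code (plain η)) (Win? (plain (1 * η))) π (All.tabulate λ {q} _ →
             (λ c≤ → subst (λ x → code q ≤ code (plain x)) (sym (+-identityʳ η)) c≤ ,
                     subst (_≤ size q + η) (sym (trans (+-identityʳ (1 * η)) (+-identityʳ η))) (m≤n+m η (size q))) ,
             (λ (c≤ , _) → subst (λ x → code q ≤ code (plain x)) (+-identityʳ η) c≤)) ⟩
      cnt (Win? (plain (1 * η))) π              ≡⟨ cnt-plain-window π 0 ⟩
      a π 1 + (a π 0 + b π 0 + E π 0)           ≡⟨ cong₂ (λ x y → a π 1 + (x + y + E π 0)) (a0≡0 shape) (b0≡0 shape) ⟩
      a π 1 + E π 0 ∎
      where open ≡-Reasoning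

    -- The two kinds of head correspond to `around` and `between`, so the level bounds cover every
    -- window headed by an actual part.
    head-kind : ∀ p → Shape p → (∃ λ s → p ≡ part s true) ⊎ (∃ λ m → p ≡ plain (suc m * η))
    head-kind (part s true)  _        = inj₁ (s , refl)
    head-kind (part s false) (pos , f) with f refl
    ... | divides zero    eq = ⊥-elim (<-irrefl (sym eq) pos)
    ... | divides (suc m) eq = inj₂ (m , cong plain eq)

    window-bound : ∀ {C R u} → LevelBounds C R u π → ∀ p → Shape p → cnt (Win? p) π ≤ C
    window-bound {C} {u = u} lb p sh with head-kind p sh
    ... | inj₁ (s , refl) = let m≤ , <m = in-level s in
      m+n≤o⇒m≤o _ (subst (λ x → x + u (s / η) ≤ C) (sym (cnt-over-window π (s / η) m≤ <m)) (LevelBounds.around lb (s / η) s m≤ <m))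
    ... | inj₂ (m , refl) =
      m+n≤o⇒m≤o _ (subst (λ x → x + u (suc m) ≤ C) (sym (cnt-plain-window π m)) (LevelBounds.between lb m))

    window-parity : ∀ {C R} → LevelBounds C R (pbit ∘ defect R C π) π → ∀ p → Shape p → cnt (Win? p) π ≡ C → BlockParity R π p
    window-parity {C} {R} lb p sh eq with head-kind p sh
    ... | inj₁ (s , refl) = let m≤ , <m = in-level s in
      trans (over-parity R (s / η) m≤ <m eq) (tight⇐ _ (LevelBounds.around lb (s / η) s m≤ <m)
        (trans (sym (cnt-over-window π (s / η) m≤ <m)) eq))
    ... | inj₂ (m , refl) =
      trans (plain-parity R m eq) (tight⇐ _ (LevelBounds.between lb m) (trans (sym (cnt-plain-window π m)) eq))

  module _ {lam : ℕ} (α : Fin lam → ℕ) where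

    InBbar⇒Shape : ∀ {j K R π} → InBbar η α j K R π → All Shape π
    InBbar⇒Shape h = Shape⇐ (proj₁ (InBbar.overpartition h)) (InBbar.cond2 h)

    module _ {π : List Part} where

      InBbar0⇒ : ∀ {n R} → InBbar η α 0 (2 + n) R π → LevelBounds (suc n) R (pbit ∘ defect R (suc n) π) π
      InBbar0⇒ {n} {R} h = record
        { around  = λ m s m≤ <m → subst (λ x → x + pbit (defect R (suc n) π m) ≤ suc n) (cnt-over-window π m m≤ <m)
            (tight⇒ _ (few (part s true)) λ eq → trans (sym (over-parity shape R m m≤ <m eq)) (block-parity (part s true) eq))
        ; between = λ m → subst (λ x → x + pbit (defect R (suc n) π (suc m)) ≤ suc n) (cnt-plain-window π m)
            (tight⇒ _ (few (plain (suc m * η))) λ eq → trans (sym (plain-parity shape R m eq)) (block-parity (plain (suc m * η)) eq))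
        ; lowest  = subst (λ x → x + 1 ≤ R) (cond4-count shape) (InBbar.cond4 h)
        }
        where
        shape = InBbar⇒Shape h
        sorted = overpartition⇒sorted (InBbar.overpartition h)
        few = far⇒window≤ sorted (suc n) (InBbar.cond3 h)
        block-parity : ∀ p → cnt (Win? p) π ≡ suc n → BlockParity R π p
        block-parity p₀ eq with block⇒window sorted n
            (λ ws p → CongMod 2 (sum (map (fl η) ws) + 1) (R + Vbar π p))
            (λ i p q e₁ e₂ near → InBbar.cond5 h i p q e₁ e₂ (proj₁ near) (proj₂ near)) p₀ eq
        ... | p , cm , same = subst (λ v → parity (sum (map (fl η) (filter (Win? p₀) π)) + 1 + (R + v)) ≡ 0ℙ)
          (trans (Vbar≡cnt π p) (trans (cnt-cong (OverBelow? p) (OverBelow? p₀) π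
             (All.map (λ (f , g) → (λ (t , c) → t , f c) , (λ (t , c) → t , g c)) same)) (sym (Vbar≡cnt π p₀))))
          (congMod2⇒parity _ (R + Vbar π p) cm)

      InBbar1⇒ : ∀ {n R} → InBbar η α 1 (suc n) R π → LevelBounds n R (λ _ → 0) π
      InBbar1⇒ {n} {R} h = record
        { around  = λ m s m≤ <m → subst (_≤ n) (trans (cnt-over-window π m m≤ <m) (sym (+-identityʳ _))) (few (part s true))
        ; between = λ m → subst (_≤ n) (trans (cnt-plain-window π m) (sym (+-identityʳ _))) (few (plain (suc m * η)))
        ; lowest  = subst (λ x → x + 1 ≤ R) (cond4-count shape) (InBbar.cond4 h)
        }
        where
        shape = InBbar⇒Shape h
        few = far⇒window≤ (overpartition⇒sorted (InBbar.overpartition h)) n (InBbar.cond3 h)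

      module _ (op : IsOverpartition π)
               (c1 : All (λ p → size p % η ≡ 0 ⊎ ∃ λ (i : Fin lam) → size p % η ≡ α i) π)
               (c2 : All (λ p → over p ≡ false → η ∣ size p) π) where

        private
          shape = Shape⇐ (proj₁ op) c2
          sorted = overpartition⇒sorted op

        ⇒InBbar0 : ∀ {n R} → LevelBounds (suc n) R (pbit ∘ defect R (suc n) π) π → InBbar η α 0 (2 + n) R π
        ⇒InBbar0 {n} {R} lb = record
          { overpartition = op ; cond1 = c1 ; cond2 = c2
          ; cond3 = λ i p q e₁ e₂ → window≤⇒far sorted (suc n) i p q (window-bound shape lb p (nth-All i shape e₁)) e₁ e₂
          ; cond4 = subst (λ x → x + 1 ≤ R) (sym (cond4-count shape)) (LevelBounds.lowest lb)
          ; cond5 = λ i p q e₁ e₂ le st →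
              let sh = nth-All i shape e₁
                  eq , block = window⇒block sorted n i p q (window-bound shape lb p sh) e₁ e₂ (le , st)
              in parity⇒congMod2 _ (R + Vbar π p) (subst (λ ws → parity (sum (map (fl η) ws) + 1 + (R + Vbar π p)) ≡ 0ℙ)
                   (sym block) (window-parity shape lb p sh eq))
          }

        ⇒InBbar1 : ∀ {n R} → LevelBounds n R (λ _ → 0) π → InBbar η α 1 (suc n) R π
        ⇒InBbar1 {n} {R} lb = record
          { overpartition = op ; cond1 = c1 ; cond2 = c2
          ; cond3 = λ i p q e₁ e₂ → window≤⇒far sorted n i p q (window-bound shape lb p (nth-All i shape e₁)) e₁ e₂
          ; cond4 = subst (λ x → x + 1 ≤ R) (sym (cond4-count shape)) (LevelBounds.lowest lb)
          ; cond5 = λ _ _ _ _ _ _ _ → 1∣ _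
          }

parity-+-cong : ∀ x x′ y y′ → parity x ≡ parity x′ → parity y ≡ parity y′ → parity (x + y) ≡ parity (x′ + y′)
parity-+-cong x x′ y y′ p q = trans (parity-+ x y) (trans (cong₂ ℙ._+_ p q) (sym (parity-+ x′ y′)))

-- Comparison of the inequalities on both sides

pbit≤1 : ∀ δ → pbit δ ≤ 1
pbit≤1 0ℙ = z≤n
pbit≤1 1ℙ = ≤-refl

parity-pbit : ∀ δ → parity (pbit δ) ≡ δ
parity-pbit 0ℙ = refl
parity-pbit 1ℙ = refl

parity-suc≢ : ∀ n → parity (suc n) ≢ parity n
parity-suc≢ (suc (suc n)) eq = parity-suc≢ n eq

-- A number of the parity of `n` cannot equal `suc n`. This is how the discrepancies of 1 between
-- the two sides are absorbed.
same-parity-gap : ∀ {x n} → parity x ≡ parity n → x ≤ suc n → x ≤ n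
same-parity-gap {x} {n} eq x≤ with m≤n⇒m<n∨m≡n x≤
... | inj₁ lt   = s≤s⁻¹ lt
... | inj₂ refl = ⊥-elim (parity-suc≢ n eq)

zero-or-positive : ∀ n → n ≡ 0 ⊎ 0 < n
zero-or-positive zero    = inj₁ refl
zero-or-positive (suc n) = inj₂ (s≤s z≤n)

module Balance
  (n R : ℕ) (a b c d V E : ℕ → ℕ) (δ : ℕ → Parity)
  (total : ∀ m → a m + b m ≡ c m + d m)
  (flip : ∀ m → 0 < a m + b m → d m + pbit (δ m) ≡ 1)
  (δ-def : ∀ m → δ m ≡ parity (a m + suc (R + V m + suc m * suc n)))
  (V-zero : V 0 ≡ 0) (V-suc : ∀ m → V (suc m) ≡ V m + (b m + E m))
  (b≤1 : ∀ m → b m ≤ 1) (b-zero : b 0 ≡ 0) where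

  u : ℕ → ℕ
  u m = pbit (δ m)

  balance : ∀ m → 0 < a m + b m → a m + b m + u m ≡ suc (c m)
  balance m pos = begin
    a m + b m + u m   ≡⟨ cong (_+ u m) (total m) ⟩
    c m + d m + u m   ≡⟨ +-assoc (c m) (d m) (u m) ⟩
    c m + (d m + u m) ≡⟨ cong (c m +_) (flip m pos) ⟩
    c m + 1           ≡⟨ +-comm (c m) 1 ⟩
    suc (c m)         ∎
    where open ≡-Reasoning

  ab≡0⇒c≡0 : ∀ m → a m + b m ≡ 0 → c m ≡ 0
  ab≡0⇒c≡0 m eq = m+n≡0⇒m≡0 (c m) (trans (sym (total m)) eq)

  ab≡0⇒a≡0 : ∀ m → a m + b m ≡ 0 → a m ≡ 0
  ab≡0⇒a≡0 m = m+n≡0⇒m≡0 (a m)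

  -- `u m` has the parity of `a m` plus the right-hand side, so adding `a m` once more cancels it.
  -- The result involves the lower levels only, through `V m`.
  parity-au : ∀ m → parity (a m + u m) ≡ parity (suc (R + V m + suc m * suc n))
  parity-au m = begin
    parity (a m + u m)             ≡⟨ parity-+ (a m) (u m) ⟩
    parity (a m) ℙ.+ parity (u m)  ≡⟨ cong (parity (a m) ℙ.+_) (trans (parity-pbit (δ m)) (trans (δ-def m) (parity-+ (a m) _))) ⟩
    parity (a m) ℙ.+ (parity (a m) ℙ.+ q) ≡⟨ ℙ.+-assoc (parity (a m)) (parity (a m)) q ⟨
    (parity (a m) ℙ.+ parity (a m)) ℙ.+ q ≡⟨ cong (ℙ._+ q) (ℙ.p+p≡0ℙ (parity (a m))) ⟩
    q ∎
    where
    open ≡-Reasoning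
    q = parity (suc (R + V m + suc m * suc n))

  -- The quantity in which the bounds for adjacent levels differ by at most 1 on the two sides.
  -- Its parity is that of n, so Z m ≤ suc n and Z m ≤ n are equivalent.
  Z : ℕ → ℕ
  Z m = a (suc m) + u (suc m) + E m + c m

  -- By `balance`, `c m` can be replaced by `a m + b m + u m` up to one. Then `parity-au` applies at
  -- both levels, and the two values differ by `V (suc m) - V m = b m + E m` and by one further
  -- `suc n`. The terms `b m` and `E m` cancel modulo 2, and `n` remains.
  parity-Z : ∀ m → 0 < a m + b m → parity (Z m) ≡ parity n
  parity-Z m pos = begin
    parity (Z m)                               ≡⟨ parity-even 1 (Z m) ⟨
    parity (Z m + 2)                           ≡⟨ cong parity (shuffle₁ (a (suc m)) (u (suc m)) (E m) (c m)) ⟩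
    parity ((a (suc m) + u (suc m)) + (E m + 1 + suc (c m)))
      ≡⟨ cong (λ x → parity ((a (suc m) + u (suc m)) + (E m + 1 + x))) (sym (balance m pos)) ⟩
    parity ((a (suc m) + u (suc m)) + (E m + 1 + (a m + b m + u m)))
      ≡⟨ cong parity (shuffle₂ (a (suc m)) (u (suc m)) (E m) (a m) (b m) (u m)) ⟩
    parity ((a (suc m) + u (suc m)) + (a m + u m) + (E m + 1 + b m))
      ≡⟨ parity-+-cong (a (suc m) + u (suc m) + (a m + u m)) (w′ + w) (E m + 1 + b m) (E m + 1 + b m)
           (parity-+-cong (a (suc m) + u (suc m)) w′ (a m + u m) w (parity-au (suc m)) (parity-au m)) refl ⟩
    parity (suc (R + V (suc m) + suc (suc m) * suc n) + w + (E m + 1 + b m))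
      ≡⟨ cong (λ x → parity (suc (R + x + suc (suc m) * suc n) + w + (E m + 1 + b m))) (V-suc m) ⟩
    parity (suc (R + (V m + (b m + E m)) + suc (suc m) * suc n) + w + (E m + 1 + b m))
      ≡⟨ cong parity (shuffle₃ R (V m) (b m) (E m) m n) ⟩
    parity (n + 2 * (2 + R + V m + b m + E m + suc m * suc n))
      ≡⟨ parity-even (2 + R + V m + b m + E m + suc m * suc n) n ⟩
    parity n ∎
    where
    open ≡-Reasoning
    w = suc (R + V m + suc m * suc n)
    w′ = suc (R + V (suc m) + suc (suc m) * suc n)
    shuffle₁ : ∀ a u E c → a + u + E + c + 2 ≡ (a + u) + (E + 1 + suc c)
    shuffle₁ = solve-∀
    shuffle₂ : ∀ a′ u′ E a b u → (a′ + u′) + (E + 1 + (a + b + u)) ≡ (a′ + u′) + (a + u) + (E + 1 + b)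
    shuffle₂ = solve-∀
    shuffle₃ : ∀ R V b E m n →
      suc (R + (V + (b + E)) + suc (suc m) * suc n) + suc (R + V + suc m * suc n) + (E + 1 + b) ≡
      n + 2 * (2 + R + V + b + E + suc m * suc n)
    shuffle₃ = solve-∀

  -- Since `V 1 = E 0`, the residue R - 1 in condition (5) gives this quantity exactly the parity of
  -- `R`. It plays for condition (4) the role that `Z` plays for adjacent levels.
  parity-lowest : parity (a 1 + u 1 + E 0 + 1) ≡ parity R
  parity-lowest = begin
    parity (a 1 + u 1 + E 0 + 1)    ≡⟨ cong parity (+-assoc (a 1 + u 1) (E 0) 1) ⟩
    parity (a 1 + u 1 + (E 0 + 1))  ≡⟨ parity-+-cong (a 1 + u 1) (suc (R + V 1 + 2 * suc n)) (E 0 + 1) (E 0 + 1) (parity-au 1) refl ⟩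
    parity (suc (R + V 1 + 2 * suc n) + (E 0 + 1))
      ≡⟨ cong (λ x → parity (suc (R + x + 2 * suc n) + (E 0 + 1))) (trans (V-suc 0) (cong₂ (λ x y → x + (y + E 0)) V-zero b-zero)) ⟩
    parity (suc (R + E 0 + 2 * suc n) + (E 0 + 1)) ≡⟨ cong parity (shuffle R (E 0) n) ⟩
    parity (R + 2 * (2 + E 0 + n))  ≡⟨ parity-even (2 + E 0 + n) R ⟩
    parity R ∎
    where
    open ≡-Reasoning
    shuffle : ∀ R E n → suc (R + E + 2 * suc n) + (E + 1) ≡ R + 2 * (2 + E + n)
    shuffle = solve-∀

  -- At an occupied level `balance` turns the two bounds into the same inequality. At an empty one
  -- `x ≤ n` suffices, because the bounds `n` and `suc n` differ by just the unit that `u m` may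
  -- take.
  around⇒ : ∀ m {x} → x ≤ n → c m + x ≤ n → a m + b m + x + u m ≤ suc n
  around⇒ m {x} x≤n h with zero-or-positive (a m + b m)
  ... | inj₁ eq rewrite eq = subst (x + u m ≤_) (+-comm n 1) (+-mono-≤ x≤n (pbit≤1 (δ m)))
  ... | inj₂ pos = begin
    a m + b m + x + u m ≡⟨ shuffle (a m + b m) x (u m) ⟩
    a m + b m + u m + x ≡⟨ cong (_+ x) (balance m pos) ⟩
    suc (c m + x)       ≤⟨ s≤s h ⟩
    suc n ∎
    where
    open ≤-Reasoning
    shuffle : ∀ p x u → p + x + u ≡ p + u + x
    shuffle = solve-∀

  around⇐ : ∀ m {x} → x ≤ n → a m + b m + x + u m ≤ suc n → c m + x ≤ n
  around⇐ m {x} x≤n h with zero-or-positive (a m + b m)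
  ... | inj₁ eq rewrite ab≡0⇒c≡0 m eq = x≤n
  ... | inj₂ pos = s≤s⁻¹ (begin
    suc (c m + x)       ≡⟨ cong (_+ x) (balance m pos) ⟨
    a m + b m + u m + x ≡⟨ shuffle (a m + b m) x (u m) ⟩
    a m + b m + x + u m ≤⟨ h ⟩
    suc n ∎)
    where
    open ≤-Reasoning
    shuffle : ∀ p x u → p + u + x ≡ p + x + u
    shuffle = solve-∀

  Z≤⇒between : ∀ m → 0 < a m + b m → Z m ≤ suc n → a (suc m) + (a m + b m + E m) + u (suc m) ≤ suc n
  Z≤⇒between m pos h = begin
    a (suc m) + (a m + b m + E m) + u (suc m)  ≤⟨ +-monoˡ-≤ (u (suc m)) (+-monoʳ-≤ (a (suc m)) (+-monoˡ-≤ (E m) ab≤)) ⟩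
    a (suc m) + (suc (c m) + E m) + u (suc m)  ≡⟨ shuffle (a (suc m)) (c m) (E m) (u (suc m)) ⟩
    suc (Z m)                                  ≤⟨ s≤s (same-parity-gap (parity-Z m pos) h) ⟩
    suc n ∎
    where
    open ≤-Reasoning
    ab≤ : a m + b m ≤ suc (c m)
    ab≤ = ≤-trans (m≤m+n _ (u m)) (≤-reflexive (balance m pos))
    shuffle : ∀ a c E u → a + (suc c + E) + u ≡ suc (a + u + E + c)
    shuffle = solve-∀

  -- With both levels occupied, `balance` rewrites the bound for `π` as `Z m ≤ n + u m` and the
  -- bound for `μ` as `Z m ≤ n + 1 - b (suc m)`; by parity each means `Z m ≤ n`. If level `m` is
  -- empty, the bound around level `suc m` suffices; if only level `suc m` is empty, `cE` gives
  -- `Z m ≤ suc n` and parity the rest.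
  between⇒ : ∀ m → E m ≤ n → c m + E m ≤ n → c (suc m) + E m ≤ n → c (suc m) + (c m + E m) ≤ n →
    a (suc m) + (a m + b m + E m) + u (suc m) ≤ suc n
  between⇒ m E≤ cE c′E h with zero-or-positive (a m + b m)
  ... | inj₁ eq rewrite eq = begin
    a (suc m) + E m + u (suc m)              ≤⟨ +-monoˡ-≤ (u (suc m)) (+-monoˡ-≤ (E m) (m≤m+n (a (suc m)) (b (suc m)))) ⟩
    a (suc m) + b (suc m) + E m + u (suc m)  ≤⟨ around⇒ (suc m) E≤ c′E ⟩
    suc n ∎
    where open ≤-Reasoning
  ... | inj₂ pos with zero-or-positive (a (suc m) + b (suc m))
  ...   | inj₁ eq′ = Z≤⇒between m pos (begin
    a (suc m) + u (suc m) + E m + c m  ≡⟨ cong (λ x → x + u (suc m) + E m + c m) (ab≡0⇒a≡0 (suc m) eq′) ⟩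
    u (suc m) + E m + c m              ≡⟨ trans (+-assoc (u (suc m)) (E m) (c m)) (cong (u (suc m) +_) (+-comm (E m) (c m))) ⟩
    u (suc m) + (c m + E m)            ≤⟨ +-mono-≤ (pbit≤1 (δ (suc m))) cE ⟩
    suc n ∎)
    where open ≤-Reasoning
  ...   | inj₂ pos′ = Z≤⇒between m pos (begin
    a (suc m) + u (suc m) + E m + c m              ≤⟨ m≤m+n _ (b (suc m)) ⟩
    a (suc m) + u (suc m) + E m + c m + b (suc m)  ≡⟨ shuffle (a (suc m)) (u (suc m)) (E m) (c m) (b (suc m)) ⟩
    a (suc m) + b (suc m) + u (suc m) + (c m + E m) ≡⟨ cong (_+ (c m + E m)) (balance (suc m) pos′) ⟩
    suc (c (suc m) + (c m + E m))                  ≤⟨ s≤s h ⟩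
    suc n ∎)
    where
    open ≤-Reasoning
    shuffle : ∀ a u E c b → a + u + E + c + b ≡ a + b + u + (c + E)
    shuffle = solve-∀

  between⇐ : ∀ m → c m + E m ≤ n → c (suc m) + E m ≤ n →
    a (suc m) + (a m + b m + E m) + u (suc m) ≤ suc n → c (suc m) + (c m + E m) ≤ n
  between⇐ m cE c′E h with zero-or-positive (a m + b m)
  ... | inj₁ eq rewrite ab≡0⇒c≡0 m eq = c′E
  ... | inj₂ pos with zero-or-positive (a (suc m) + b (suc m))
  ...   | inj₁ eq′ rewrite ab≡0⇒c≡0 (suc m) eq′ = cE
  ...   | inj₂ pos′ = s≤s⁻¹ (begin
    suc (c (suc m)) + (c m + E m)                   ≡⟨ cong (_+ (c m + E m)) (balance (suc m) pos′) ⟨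
    a (suc m) + b (suc m) + u (suc m) + (c m + E m) ≡⟨ shuffle₁ (a (suc m)) (u (suc m)) (E m) (c m) (b (suc m)) ⟩
    -- Parity sharpens `Z m ≤ suc n` to `Z m ≤ n`, which frees the unit that `b (suc m)` may take.
    Z m + b (suc m)                                 ≤⟨ +-mono-≤ (same-parity-gap (parity-Z m pos) Z≤) (b≤1 (suc m)) ⟩
    n + 1                                           ≡⟨ +-comm n 1 ⟩
    suc n ∎)
    where
    open ≤-Reasoning
    shuffle₁ : ∀ a u E c b → a + b + u + (c + E) ≡ a + u + E + c + b
    shuffle₁ = solve-∀
    shuffle₂ : ∀ a′ u′ E p u → a′ + u′ + E + (p + u) ≡ a′ + (p + E) + u′ + u
    shuffle₂ = solve-∀
    Z≤ : Z m ≤ suc n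
    Z≤ = s≤s⁻¹ (begin
      suc (a (suc m) + u (suc m) + E m + c m)         ≡⟨ +-suc (a (suc m) + u (suc m) + E m) (c m) ⟨
      a (suc m) + u (suc m) + E m + suc (c m)         ≡⟨ cong (a (suc m) + u (suc m) + E m +_) (balance m pos) ⟨
      a (suc m) + u (suc m) + E m + (a m + b m + u m) ≡⟨ shuffle₂ (a (suc m)) (u (suc m)) (E m) (a m + b m) (u m) ⟩
      a (suc m) + (a m + b m + E m) + u (suc m) + u m ≤⟨ +-mono-≤ h (pbit≤1 (δ m)) ⟩
      suc n + 1                                       ≡⟨ +-comm (suc n) 1 ⟩
      suc (suc n) ∎)

  lowest⇒ : c 1 + E 0 + 1 ≤ R → a 1 + E 0 + 1 ≤ R
  lowest⇒ h with zero-or-positive (a 1 + b 1)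
  ... | inj₁ eq rewrite ab≡0⇒a≡0 1 eq | ab≡0⇒c≡0 1 eq = h
  ... | inj₂ pos = ≤-trans (+-monoˡ-≤ 1 (+-monoˡ-≤ (E 0) (m≤m+n (a 1) (u 1)))) (same-parity-gap parity-lowest (begin
    a 1 + u 1 + E 0 + 1          ≤⟨ m≤m+n _ (b 1) ⟩
    a 1 + u 1 + E 0 + 1 + b 1    ≡⟨ shuffle (a 1) (u 1) (E 0) (b 1) ⟩
    a 1 + b 1 + u 1 + (E 0 + 1)  ≡⟨ cong (_+ (E 0 + 1)) (balance 1 pos) ⟩
    suc (c 1 + (E 0 + 1))        ≡⟨ cong suc (sym (+-assoc (c 1) (E 0) 1)) ⟩
    suc (c 1 + E 0 + 1)          ≤⟨ s≤s h ⟩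
    suc R ∎))
    where
    open ≤-Reasoning
    shuffle : ∀ a u E b → a + u + E + 1 + b ≡ a + b + u + (E + 1)
    shuffle = solve-∀

  lowest⇐ : a 1 + E 0 + 1 ≤ R → c 1 + E 0 + 1 ≤ R
  lowest⇐ h with zero-or-positive (a 1 + b 1)
  ... | inj₁ eq = subst (λ x → x + E 0 + 1 ≤ R) (trans (ab≡0⇒a≡0 1 eq) (sym (ab≡0⇒c≡0 1 eq))) h
  ... | inj₂ pos = s≤s⁻¹ (begin
    suc (c 1) + E 0 + 1        ≡⟨ cong (λ x → x + E 0 + 1) (balance 1 pos) ⟨
    a 1 + b 1 + u 1 + E 0 + 1  ≡⟨ shuffle₁ (a 1) (b 1) (u 1) (E 0) ⟩
    a 1 + u 1 + E 0 + 1 + b 1  ≤⟨ +-mono-≤ (same-parity-gap parity-lowest Q≤) (b≤1 1) ⟩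
    R + 1                      ≡⟨ +-comm R 1 ⟩
    suc R ∎)
    where
    open ≤-Reasoning
    shuffle₁ : ∀ a b u E → a + b + u + E + 1 ≡ a + u + E + 1 + b
    shuffle₁ = solve-∀
    shuffle₂ : ∀ a u E → a + u + E + 1 ≡ a + E + 1 + u
    shuffle₂ = solve-∀
    Q≤ : a 1 + u 1 + E 0 + 1 ≤ suc R
    Q≤ = begin
      a 1 + u 1 + E 0 + 1 ≡⟨ shuffle₂ (a 1) (u 1) (E 0) ⟩
      a 1 + E 0 + 1 + u 1 ≤⟨ +-mono-≤ h (pbit≤1 (δ 1)) ⟩
      R + 1               ≡⟨ +-comm R 1 ⟩
      suc R ∎

-- Overpartitions from multiplicities

All⇐mult : ∀ {P : Part → Set} π → (∀ s o → 0 < mult π s o → P (part s o)) → All P π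
All⇐mult π f = All.tabulate λ {q} q∈ → f (size q) (over q) (cnt-∈ (Is? (size q) (over q)) q∈ (refl , refl))

All⇒mult : ∀ {P : Part → Set} {π} → All P π → ∀ {s o} → 0 < mult π s o → P (part s o)
All⇒mult all {s} {o} pos with cnt-witness (Is? s o) pos
... | q , q∈ , refl , refl = All.lookup all q∈

mult-absent : ∀ {P : Part → Set} {π} → All P π → ∀ {s o} → ¬ P (part s o) → mult π s o ≡ 0
mult-absent all ¬p = n≤0⇒n≡0 (≮⇒≥ λ pos → ¬p (All⇒mult all pos))

-- Each head is the largest member of its list and occurs in the other list, so the heads coincide
-- and can be removed. Equality of overpartitions is thereby reduced to equality of multiplicities.
sorted-ext : ∀ {π π′} → Sorted π → Sorted π′ → (∀ s o → mult π s o ≡ mult π′ s o) → π ≡ π′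
sorted-ext {[]}    {[]}     _ _ _ = refl
sorted-ext {[]}    {y ∷ ys} _ _ eq =
  ⊥-elim (<-irrefl (eq (size y) (over y)) (cnt-∈ (Is? (size y) (over y)) (here refl) (refl , refl)))
sorted-ext {x ∷ xs} {[]}    _ _ eq =
  ⊥-elim (<-irrefl (sym (eq (size x) (over x))) (cnt-∈ (Is? (size x) (over x)) (here refl) (refl , refl)))
sorted-ext {x ∷ xs} {y ∷ ys} (hx ∷ sx) (hy ∷ sy) eq
  with code-injective x y (≤-antisym
    (All⇒mult {P = λ q → code q ≤ code y} {y ∷ ys} (≤-refl ∷ hy) {size x} {over x} (subst (0 <_) (eq (size x) (over x)) (cnt-∈ (Is? (size x) (over x)) (here refl) (refl , refl))))
    (All⇒mult {P = λ q → code q ≤ code x} {x ∷ xs} (≤-refl ∷ hx) {size y} {over y} (subst (0 <_) (sym (eq (size y) (over y))) (cnt-∈ (Is? (size y) (over y)) (here refl) (refl , refl)))))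
... | refl = cong (x ∷_) (sorted-ext sx sy λ s o → +-cancelˡ-≡ (𝟙 (Is? s o x)) _ _
      (trans (sym (cnt-∷ (Is? s o) x xs)) (trans (eq s o) (cnt-∷ (Is? s o) x ys))))

-- `Adj` permits a repetition only for plain parts, so two overlined members of one size cannot both
-- occur.
cnt-overlined≤1 : ∀ {P : Part → Set} (P? : Decidable P) {π} → AllPairs Adj π → All (λ q → P q → over q ≡ true) π →
  (∀ x y → P x → P y → size x ≡ size y) → cnt P? π ≤ 1
cnt-overlined≤1 {P} P? {π} adj ov same = cnt≤1 P? (go adj ov)
  where
  clash : ∀ {x y} → Adj x y → (P x → over x ≡ true) → (P y → over y ≡ true) → P x → ¬ P y
  clash {x} {y} (inj₁ lt) ox oy px py =
    <-irrefl (cong₂ (λ s o → code (part s o)) (same y x py px) (trans (oy py) (sym (ox px)))) lt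
  clash (inj₂ (_ , f)) ox oy px py with () ← trans (sym f) (ox px)
  go : ∀ {π} → AllPairs Adj π → All (λ q → P q → over q ≡ true) π → AllPairs (λ x y → P x → ¬ P y) π
  go []       []       = []
  go (h ∷ hs) (o ∷ os) = All.zipWith (λ (ad , oy) → clash ad o oy) (h , os) ∷ go hs os

mult-over≤1 : ∀ {π} → AllPairs Adj π → ∀ s → mult π s true ≤ 1
mult-over≤1 {π} adj s = cnt-overlined≤1 (Is? s true) adj (All.tabulate λ _ → proj₂)
  (λ x y (ex , _) (ey , _) → trans ex (sym ey))

module Build (A : ℕ → ℕ) (O : ℕ → Bool) where

  chunk : ℕ → List Part
  chunk s = (if O s then part s true ∷ [] else []) ++ replicate (A s) (plain s)

  build : ℕ → List Part
  build zero    = []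
  build (suc B) = chunk B ++ build B

  chunk-size : ∀ s → All (λ q → size q ≡ s) (chunk s)
  chunk-size s with O s
  ... | true  = refl ∷ All.replicate⁺ (A s) refl
  ... | false = All.replicate⁺ (A s) refl

  build-size : ∀ B → All (λ q → size q < B) (build B)
  build-size zero    = []
  build-size (suc B) = All.++⁺ (All.map (λ eq → s≤s (≤-reflexive eq)) (chunk-size B))
                               (All.map m<n⇒m<1+n (build-size B))

  replicate-Adj : ∀ k s → AllPairs Adj (replicate k (plain s))
  replicate-Adj zero    s = []
  replicate-Adj (suc k) s = All.replicate⁺ k (inj₂ (refl , refl)) ∷ replicate-Adj k s

  chunk-Adj : ∀ s → AllPairs Adj (chunk s)
  chunk-Adj s with O s
  ... | true  = All.replicate⁺ (A s) (inj₁ (+-monoʳ-< (2 * s) (s≤s z≤n))) ∷ replicate-Adj (A s) s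
  ... | false = replicate-Adj (A s) s

  build-Adj : ∀ B → AllPairs Adj (build B)
  build-Adj zero    = []
  build-Adj (suc B) = AllPairs.++⁺ (chunk-Adj B) (build-Adj B)
    (All.map (λ {x} eqx → All.map (λ {y} lt → inj₁ (smaller x y (subst (size y <_) (sym eqx) lt))) (build-size B)) (chunk-size B))
    where
    smaller : ∀ x y → size y < size x → code y < code x
    smaller x y lt = <-≤-trans (code<plain⁺ y lt) (≤-trans (≤-reflexive (code-plain (size x))) (2size≤code x))

  mult-replicate : ∀ k s → mult (replicate k (plain s)) s false ≡ k
  mult-replicate zero    s = refl
  mult-replicate (suc k) s = trans (cnt-accept (Is? s false) (refl , refl)) (cong suc (mult-replicate k s))

  no-over-replicate : ∀ k s → mult (replicate k (plain s)) s true ≡ 0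
  no-over-replicate k s = mult-absent {P = λ q → over q ≡ false} (All.replicate⁺ k refl) λ ()

  chunk-plain : ∀ s → mult (chunk s) s false ≡ A s
  chunk-plain s with O s
  ... | true  = trans (cnt-reject (Is? s false) {part s true} {replicate (A s) (plain s)} λ ()) (mult-replicate (A s) s)
  ... | false = mult-replicate (A s) s

  chunk-over : ∀ s → mult (chunk s) s true ≡ bit (O s)
  chunk-over s with O s
  ... | true  = trans (cnt-accept (Is? s true) (refl , refl)) (cong suc (no-over-replicate (A s) s))
  ... | false = no-over-replicate (A s) s

  mult-build : (f : ℕ → ℕ) (o : Bool) → (∀ s → mult (chunk s) s o ≡ f s) → ∀ B s → s < B → mult (build B) s o ≡ f s
  mult-build f o eq (suc B) s s<B with s ≟ B
  ... | yes refl = begin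
    mult (chunk s ++ build s) s o          ≡⟨ cnt-++ (Is? s o) (chunk s) (build s) ⟩
    mult (chunk s) s o + mult (build s) s o ≡⟨ cong₂ _+_ (eq s) (mult-absent (build-size s) (<-irrefl refl)) ⟩
    f s + 0                                ≡⟨ +-identityʳ (f s) ⟩
    f s ∎
    where open ≡-Reasoning
  ... | no s≢B = begin
    mult (chunk B ++ build B) s o          ≡⟨ cnt-++ (Is? s o) (chunk B) (build B) ⟩
    mult (chunk B) s o + mult (build B) s o ≡⟨ cong₂ _+_ (mult-absent (chunk-size B) s≢B) (mult-build f o eq B s (≤∧≢⇒< (s≤s⁻¹ s<B) s≢B)) ⟩
    f s ∎
    where open ≡-Reasoning

  module _ (B : ℕ) (A-support : ∀ s → B ≤ s → A s ≡ 0) (O-support : ∀ s → B ≤ s → O s ≡ false) where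

    mult-plain : ∀ s → mult (build B) s false ≡ A s
    mult-plain s with s <? B
    ... | yes lt = mult-build A false chunk-plain B s lt
    ... | no ¬lt = trans (mult-absent (build-size B) ¬lt) (sym (A-support s (≮⇒≥ ¬lt)))

    mult-over : ∀ s → mult (build B) s true ≡ bit (O s)
    mult-over s with s <? B
    ... | yes lt = mult-build (bit ∘ O) true chunk-over B s lt
    ... | no ¬lt = trans (mult-absent (build-size B) ¬lt) (sym (cong bit (O-support s (≮⇒≥ ¬lt))))

distinct : ∀ {π} → AllPairs Adj π → (∀ s o → mult π s o ≤ 1) → AllPairs (λ p q → q <ₚ p) π
distinct []       few = []
distinct {x ∷ xs} (h ∷ hs) few =
  All.tabulate (λ y∈ → strict y∈ (All.lookup h y∈)) ∷
  distinct hs λ s o → ≤-trans (m≤n+m _ (𝟙 (Is? s o x))) (≤-trans (≤-reflexive (sym (cnt-∷ (Is? s o) x xs))) (few s o))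
  where
  strict : ∀ {y} → y ∈ xs → Adj x y → y <ₚ x
  strict y∈ (inj₁ lt)         = lt
  strict y∈ (inj₂ (refl , _)) = ⊥-elim (<⇒≱ (s≤s (cnt-∈ (Is? (size x) (over x)) y∈ (refl , refl)))
    (≤-trans (≤-reflexive (sym (cnt-accept (Is? (size x) (over x)) (refl , refl)))) (few (size x) (over x))))

-- The relation between (ζ, μ) and π, and the transfer of bounds along it

module Relation (η : ℕ) .{{_ : NonZero η}} where

  open Conditions η public

  residue-unique : ∀ {x y} → x ≤ y → y < x + η → x % η ≡ y % η → x ≡ y
  residue-unique {x} {y} x≤y y<x+η eq = trans (decomp x) (trans (cong₂ (λ r q → r + q * η) eq qeq) (sym (decomp y)))
    where
    decomp : ∀ z → z ≡ z % η + z / η * η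
    decomp z = m≡m%n+[m/n]*n z η
    qx≤ : x / η * η ≤ y / η * η
    qx≤ = +-cancelˡ-≤ (y % η) _ _ (subst (λ r → r + x / η * η ≤ y % η + y / η * η) eq (subst₂ _≤_ (decomp x) (decomp y) x≤y))
    qy< : y / η * η < η + x / η * η
    qy< = +-cancelˡ-< (y % η) _ _ (subst₂ _<_ (decomp y)
      (trans (cong (_+ η) (trans (decomp x) (cong (_+ x / η * η) eq))) (trans (+-assoc (y % η) _ η) (cong (y % η +_) (+-comm _ η)))) y<x+η)
    qeq : x / η ≡ y / η
    qeq = level-unique (y / η) (x / η) {y / η * η} ≤-refl (m<sucm (y / η)) qx≤ qy<

  -- The sizes concerned are less than η apart, so each residue class contains at most one of them;
  -- a non-multiple is overlined and hence occurs at most once. The residues α then serve as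
  -- pigeonholes.
  X≤classes : ∀ {lam} (α : Fin lam → ℕ) {π} → IsOverpartition π → All Shape π →
    All (λ p → size p % η ≡ 0 ⊎ ∃ λ (i : Fin lam) → size p % η ≡ α i) π → ∀ s → X π s ≤ lam
  X≤classes {lam} α {π} (_ , lnk) shape c1 s = cnt≤classes lam (NonIn? l (suc s)) (λ i q → size q % η ≟ α i) π
    (All.map (λ {q} h (¬d , _) → class q h ¬d) c1)
    λ i → cnt-overlined≤1 (λ q → NonIn? l (suc s) q ×-dec (size q % η ≟ α i)) (Linked⇒AllPairs Adj-trans lnk)
      (All.map (λ {q} sh ((¬d , _) , _) → nonmultiple-over q sh ¬d) shape)
      λ x y (nx , ex) (ny , ey) → same {x} {y} nx ny (trans ex (sym ey))
    where
    l = suc s ∸ η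
    class : ∀ q → size q % η ≡ 0 ⊎ (∃ λ (i : Fin lam) → size q % η ≡ α i) → ¬ (η ∣ size q) → ∃ λ i → size q % η ≡ α i
    class q (inj₁ z) ¬d = ⊥-elim (¬d (m%n≡0⇒n∣m (size q) η z))
    class q (inj₂ h) _  = h
    close : ∀ {x y} → NonIn l (suc s) x → NonIn l (suc s) y → size y < size x + η
    close {x} {y} (_ , l≤ , _) (_ , _ , <h) = <-≤-trans <h (≤-trans (m≤n+m∸n (suc s) η)
      (≤-trans (+-monoʳ-≤ η l≤) (≤-reflexive (+-comm η (size x)))))
    same : ∀ {x y} → NonIn l (suc s) x → NonIn l (suc s) y → size x % η ≡ size y % η → size x ≡ size y
    same {x} {y} nx ny eq with ≤-total (size x) (size y)
    ... | inj₁ le = residue-unique le (close {x} {y} nx ny) eq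
    ... | inj₂ ge = sym (residue-unique ge (close {y} {x} ny nx) (sym eq))

  suc-pred-level : ∀ m → suc (pred (suc m * η)) ≡ suc m * η
  suc-pred-level m = suc-pred (suc m * η) {{>-nonZero (≤-<-trans z≤n (m<sucm m))}}

  -- Multiples of η are not counted, so the stretch between `m * η` and `suc m * η` is seen by the
  -- window ending just below `suc m * η` as well as by the one ending at it. The first belongs to
  -- level `m`, the second (`E≡X-next`) to level `suc m`; `around` therefore bounds `E m` together
  -- with either neighbouring multiplicity.
  E≡X-top : ∀ π m → E π m ≡ X π (pred (suc m * η))
  E≡X-top π m = cong₂ (e π) (trans (sym (m+n∸m≡n η (m * η))) (cong (_∸ η) (sym (suc-pred-level m)))) (sym (suc-pred-level m))

  E≡X-next : ∀ π m → E π m ≡ X π (suc m * η)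
  E≡X-next π m = cnt-cong (NonIn? (m * η) (suc m * η)) (NonIn? (suc (suc m * η) ∸ η) (suc (suc m * η))) π
    (All.tabulate λ {q} _ → to q , from q)
    where
    shift : suc (suc m * η) ∸ η ≡ suc (m * η)
    shift = trans (cong (_∸ η) (sym (+-suc η (m * η)))) (m+n∸m≡n η (suc (m * η)))
    to : ∀ q → NonIn (m * η) (suc m * η) q → NonIn (suc (suc m * η) ∸ η) (suc (suc m * η)) q
    to q (¬d , l≤ , <h) = ¬d , subst (_≤ size q) (sym shift) (≤∧≢⇒< l≤ λ eq → ¬d (divides m (sym eq))) , m<n⇒m<1+n <h
    from : ∀ q → NonIn (suc (suc m * η) ∸ η) (suc (suc m * η)) q → NonIn (m * η) (suc m * η) q
    from q (¬d , l≤ , <h) = ¬d , <⇒≤ (subst (_≤ size q) shift l≤) , ≤∧≢⇒< (s≤s⁻¹ <h) λ eq → ¬d (divides (suc m) eq)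

  -- A relation in place of a map keeps the two directions symmetric: weight, membership and
  -- uniqueness are derived from these three fields, and the two explicit constructions need only
  -- satisfy them.
  record Rel (n R : ℕ) (ζ μ π : List Part) : Set where
    field
      total   : ∀ m → a π m + b π m ≡ a μ m + a ζ m
      nonmult : ∀ s → ¬ (η ∣ s) → cntKey size π s ≡ cntKey size μ s
      flip    : ∀ m → 0 < a π m + b π m → a ζ m + pbit (defect R (suc n) π m) ≡ 1

  NoOverMultiple : List Part → Set
  NoOverMultiple = All (λ p → over p ≡ true → ¬ (η ∣ size p))

  b≡0 : ∀ {μ} → NoOverMultiple μ → ∀ m → b μ m ≡ 0
  b≡0 noOver m = mult-absent noOver λ f → f refl (divides m refl)

  V0≡0 : ∀ π → V π 0 ≡ 0
  V0≡0 π = cnt-none (OverIn? 0 0) {π} (All.tabulate λ _ (_ , _ , lt) → n≮0 lt)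

  nonmult⇒e : ∀ π μ → (∀ s → ¬ (η ∣ s) → cntKey size π s ≡ cntKey size μ s) → ∀ l h → e π l h ≡ e μ l h
  nonmult⇒e π μ eq l h = cntKey-local size (NonInSize? l h) π μ λ s (¬d , _) → eq s ¬d

  module Transfer {n R R′ : ℕ} (R-R′ : R′ ≡ R ⊎ (R ≡ 2 + n × R′ ≡ 1 + n)) {ζ μ π : List Part}
    (rel : Rel n R ζ μ π) (shape : All Shape π) (adj : AllPairs Adj π)
    (noOver : NoOverMultiple μ) (X≤n : ∀ s → X π s ≤ n) where

    open Rel rel
    open Balance n R (a π) (b π) (a μ) (a ζ) (V π) (E π) (defect R (suc n) π) total flip (λ _ → refl)
      (V0≡0 π) (V-suc shape) (λ m → mult-over≤1 adj (m * η)) (b0≡0 shape)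

    E≤n : ∀ m → E π m ≤ n
    E≤n m = subst (_≤ n) (sym (E≡X-top π m)) (X≤n _)

    X-eq : ∀ s → X π s ≡ X μ s
    X-eq s = nonmult⇒e π μ nonmult (suc s ∸ η) (suc s)

    E-eq : ∀ m → E π m ≡ E μ m
    E-eq m = nonmult⇒e π μ nonmult (m * η) (suc m * η)

    around-μ : ∀ m s → a μ m + b μ m + X μ s + 0 ≡ a μ m + X π s
    around-μ m s rewrite b≡0 noOver m | X-eq s | +-identityʳ (a μ m) = +-identityʳ (a μ m + X μ s)

    between-μ : ∀ m → a μ (suc m) + (a μ m + b μ m + E μ m) + 0 ≡ a μ (suc m) + (a μ m + E π m)
    between-μ m rewrite b≡0 noOver m | E-eq m | +-identityʳ (a μ m) = +-identityʳ (a μ (suc m) + (a μ m + E μ m))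

    module _ (cX : ∀ m s → m * η ≤ s → s < η + m * η → a μ m + X π s ≤ n) where

      cE : ∀ m → a μ m + E π m ≤ n
      cE m = subst (λ x → a μ m + x ≤ n) (sym (E≡X-top π m))
        (cX m _ (s≤s⁻¹ (subst (m * η <_) (sym (suc-pred-level m)) (m<sucm m))) (≤-reflexive (suc-pred-level m)))

      c′E : ∀ m → a μ (suc m) + E π m ≤ n
      c′E m = subst (λ x → a μ (suc m) + x ≤ n) (sym (E≡X-next π m)) (cX (suc m) _ ≤-refl (m<sucm (suc m)))

    levels⇒ : LevelBounds n R′ (λ _ → 0) μ → LevelBounds (suc n) R (pbit ∘ defect R (suc n) π) π
    levels⇒ lb = record
      { around  = λ m s m≤ <m → around⇒ m (X≤n s) (cX m s m≤ <m)
      ; between = λ m → between⇒ m (E≤n m) (cE cX m) (c′E cX m) (subst (_≤ n) (between-μ m) (LevelBounds.between lb m))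
      ; lowest  = low R-R′ (subst (λ x → a μ 1 + x + 1 ≤ R′) (sym (E-eq 0)) (LevelBounds.lowest lb))
      }
      where
      cX : ∀ m s → m * η ≤ s → s < η + m * η → a μ m + X π s ≤ n
      cX m s m≤ <m = subst (_≤ n) (around-μ m s) (LevelBounds.around lb m s m≤ <m)
      low : R′ ≡ R ⊎ (R ≡ 2 + n × R′ ≡ 1 + n) → a μ 1 + E π 0 + 1 ≤ R′ → a π 1 + E π 0 + 1 ≤ R
      low (inj₁ refl)       h = lowest⇒ h
      -- In the case r = k condition (4) carries no information: the window of the overlined part η
      -- already holds at most `suc n` parts, including those counted by `a π 1 + E π 0`.
      low (inj₂ (refl , _)) _ = subst (_≤ 2 + n) (+-comm 1 _) (s≤s (≤-trans (+-monoˡ-≤ (E π 0) (m≤m+n (a π 1) (b π 1)))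
        (m+n≤o⇒m≤o _ (around⇒ 1 (E≤n 0) (c′E cX 0)))))

    levels⇐ : LevelBounds (suc n) R (pbit ∘ defect R (suc n) π) π → LevelBounds n R′ (λ _ → 0) μ
    levels⇐ lb = record
      { around  = λ m s m≤ <m → subst (_≤ n) (sym (around-μ m s)) (cX m s m≤ <m)
      ; between = λ m → subst (_≤ n) (sym (between-μ m)) (between⇐ m (cE cX m) (c′E cX m) (LevelBounds.between lb m))
      ; lowest  = subst (λ x → a μ 1 + x + 1 ≤ R′) (E-eq 0) (low R-R′ (LevelBounds.lowest lb))
      }
      where
      cX : ∀ m s → m * η ≤ s → s < η + m * η → a μ m + X π s ≤ n
      cX m s m≤ <m = around⇐ m (X≤n s) (LevelBounds.around lb m s m≤ <m)
      low : R′ ≡ R ⊎ (R ≡ 2 + n × R′ ≡ 1 + n) → a π 1 + E π 0 + 1 ≤ R → a μ 1 + E π 0 + 1 ≤ R′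
      low (inj₁ refl)       h = lowest⇐ h
      -- The windows of `μ` hold at most `n` parts, so the lowered parameter `1 + n` is met
      -- automatically.
      low (inj₂ (_ , refl)) _ = subst (_≤ 1 + n) (+-comm 1 _) (s≤s (c′E cX 0))

-- The bijection

isOdd : Parity → Bool
isOdd 0ℙ = false
isOdd 1ℙ = true

bit-isOdd : ∀ p → bit (isOdd p) ≡ pbit p
bit-isOdd 0ℙ = refl
bit-isOdd 1ℙ = refl

bit-0< : ∀ {x} → x ≤ 1 → bit (0 <ᵇ x) ≡ x
bit-0< {zero}  _         = refl
bit-0< {suc .0} (s≤s z≤n) = refl

pbit-injective : ∀ p q → pbit p ≡ pbit q → p ≡ q
pbit-injective 0ℙ 0ℙ _ = refl
pbit-injective 1ℙ 1ℙ _ = refl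

parity-injective-≤1 : ∀ {x y} → x ≤ 1 → y ≤ 1 → parity x ≡ parity y → x ≡ y
parity-injective-≤1 z≤n       z≤n       _ = refl
parity-injective-≤1 (s≤s z≤n) (s≤s z≤n) _ = refl
parity-injective-≤1 z≤n       (s≤s z≤n) ()
parity-injective-≤1 (s≤s z≤n) z≤n       ()

opposite-pbit : ∀ {d} → d ≤ 1 → d + pbit (parity (suc d)) ≡ 1
opposite-pbit {zero}   _         = refl
opposite-pbit {suc .0} (s≤s z≤n) = refl

pbit-⁻¹ : ∀ p → pbit (p ℙ.⁻¹) + pbit p ≡ 1
pbit-⁻¹ 0ℙ = refl
pbit-⁻¹ 1ℙ = refl

ifPositive : {X : Set} → ℕ → X → X → X
ifPositive zero    x y = y
ifPositive (suc _) x y = x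

ifPositive-yes : ∀ {X : Set} {n} {x y : X} → 0 < n → ifPositive n x y ≡ x
ifPositive-yes {n = suc _} _ = refl

ifPositive-no : ∀ {X : Set} {n} {x y : X} → n ≡ 0 → ifPositive n x y ≡ y
ifPositive-no refl = refl

module Correspondence (η : ℕ) .{{_ : NonZero η}} (n R : ℕ) where

  open Relation η public

  byLevel : {X : Set} → (ℕ → X) → (ℕ → X) → ℕ → X
  byLevel f g s with η ∣? s
  ... | yes _ = f (s / η)
  ... | no  _ = g s

  byLevel-mult : {X : Set} (f g : ℕ → X) → ∀ m → byLevel f g (m * η) ≡ f m
  byLevel-mult f g m with η ∣? m * η
  ... | yes _ = cong f (m*n/n≡m m η)
  ... | no ¬d = ⊥-elim (¬d (divides m refl))

  byLevel-non : {X : Set} (f g : ℕ → X) → ∀ {s} → ¬ (η ∣ s) → byLevel f g s ≡ g s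
  byLevel-non f g {s} ¬d with η ∣? s
  ... | yes d = ⊥-elim (¬d d)
  ... | no  _ = refl

  byLevel-support : {X : Set} (f g : ℕ → X) (B : ℕ) {x : X} →
    (∀ m → B ≤ m * η → f m ≡ x) → (∀ s → B ≤ s → g s ≡ x) → ∀ s → B ≤ s → byLevel f g s ≡ x
  byLevel-support f g B hf hg s le with η ∣? s
  ... | yes (divides m refl) = trans (cong f (m*n/n≡m m η)) (hf m le)
  ... | no  _                = hg s le

  nonmult-plain : ∀ {π} → All Shape π → ∀ {s} → ¬ (η ∣ s) → mult π s false ≡ 0
  nonmult-plain shape ¬d = mult-absent shape λ (_ , f) → ¬d (f refl)

  nonmult-cntKey : ∀ {π} → All Shape π → ∀ {s} → ¬ (η ∣ s) → cntKey size π s ≡ mult π s true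
  nonmult-cntKey {π} shape {s} ¬d = trans (cntKey≡mult π s) (cong (_+ mult π s true) (nonmult-plain shape ¬d))

  mult-beyond : ∀ π {s} o → ∣ π ∣ₒ < s → mult π s o ≡ 0
  mult-beyond π o lt = mult-absent (key-bounded size π) λ s< → <⇒≱ lt (s≤s⁻¹ s<)

  InD⇒strict : ∀ {ζ} → InD η ζ → AllPairs (λ p q → q <ₚ p) ζ
  InD⇒strict (_ , lnk) = Linked⇒AllPairs (λ q<p s<q → <-trans s<q q<p) lnk

  module _ {ζ : List Part} (inD : InD η ζ) where

    ζ-over : ∀ s → mult ζ s true ≡ 0
    ζ-over s = mult-absent (proj₁ inD) λ { (_ , () , _) }

    ζ-nonmult : ∀ {s} o → ¬ (η ∣ s) → mult ζ s o ≡ 0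
    ζ-nonmult o ¬d = mult-absent (proj₁ inD) λ (_ , _ , d) → ¬d d

    ζ-zero : a ζ 0 ≡ 0
    ζ-zero = mult-absent (proj₁ inD) λ { (() , _) }

    ζ≤1 : ∀ m → a ζ m ≤ 1
    ζ≤1 m = cnt≤1 (Plain? m) (AllPairs.map (λ {x} {y} lt (ex , fx) (ey , fy) →
      <-irrefl (cong₂ (λ s o → code (part s o)) (trans ey (sym ex)) (trans fy (sym fx))) lt) (InD⇒strict inD))

    ζ-sorted : Sorted ζ
    ζ-sorted = AllPairs.map <⇒≤ (InD⇒strict inD)

  Rel-weight : ∀ {ζ μ π} → InD η ζ → NoOverMultiple μ → Rel n R ζ μ π → ∣ π ∣ₒ ≡ ∣ ζ ∣ₒ + ∣ μ ∣ₒ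
  Rel-weight {ζ} {μ} {π} inD noOver rel = sum-additive size π ζ μ pointwise
    where
    open ≡-Reasoning
    pointwise : ∀ s → cntKey size π s ≡ cntKey size ζ s + cntKey size μ s
    pointwise s with η ∣? s
    ... | yes (divides m refl) = begin
      cntKey size π (m * η)                                   ≡⟨ cntKey≡mult π (m * η) ⟩
      a π m + b π m                                           ≡⟨ Rel.total rel m ⟩
      a μ m + a ζ m                                           ≡⟨ +-comm (a μ m) (a ζ m) ⟩
      a ζ m + a μ m                                           ≡⟨ cong₂ _+_ (+-identityʳ (a ζ m)) (+-identityʳ (a μ m)) ⟨
      (a ζ m + 0) + (a μ m + 0)
        ≡⟨ cong₂ (λ x y → (a ζ m + x) + (a μ m + y)) (ζ-over inD (m * η)) (b≡0 noOver m) ⟨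
      (a ζ m + b ζ m) + (a μ m + b μ m)                       ≡⟨ cong₂ _+_ (cntKey≡mult ζ (m * η)) (cntKey≡mult μ (m * η)) ⟨
      cntKey size ζ (m * η) + cntKey size μ (m * η)           ∎
    ... | no ¬d = begin
      cntKey size π s                    ≡⟨ Rel.nonmult rel s ¬d ⟩
      cntKey size μ s                    ≡⟨ cong (_+ cntKey size μ s) (trans (cntKey≡mult ζ s) (cong₂ _+_ (ζ-nonmult inD false ¬d) (ζ-nonmult inD true ¬d))) ⟨
      cntKey size ζ s + cntKey size μ s  ∎

  module _ {ζ μ ζ′ μ′ π : List Part} (rel : Rel n R ζ μ π) (rel′ : Rel n R ζ′ μ′ π) where

    Rel-ζ : ∀ m → a ζ m ≡ a ζ′ m
    Rel-ζ m with zero-or-positive (a π m + b π m)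
    ... | inj₁ z   = trans (m+n≡0⇒n≡0 (a μ m) (trans (sym (Rel.total rel m)) z))
                           (sym (m+n≡0⇒n≡0 (a μ′ m) (trans (sym (Rel.total rel′ m)) z)))
    ... | inj₂ pos = +-cancelʳ-≡ (pbit (defect R (suc n) π m)) (a ζ m) (a ζ′ m)
                       (trans (Rel.flip rel m pos) (sym (Rel.flip rel′ m pos)))

    Rel-μ : ∀ m → a μ m ≡ a μ′ m
    Rel-μ m = +-cancelʳ-≡ (a ζ m) (a μ m) (a μ′ m)
      (trans (sym (Rel.total rel m)) (trans (Rel.total rel′ m) (cong (a μ′ m +_) (sym (Rel-ζ m)))))

    Rel-injective : InD η ζ → InD η ζ′ → Sorted μ → Sorted μ′ → All Shape μ → All Shape μ′ →
      NoOverMultiple μ → NoOverMultiple μ′ → ζ ≡ ζ′ × μ ≡ μ′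
    Rel-injective inD inD′ so so′ sh sh′ noOver noOver′ =
      sorted-ext (ζ-sorted inD) (ζ-sorted inD′) eqζ , sorted-ext so so′ eqμ
      where
      eqζ : ∀ s o → mult ζ s o ≡ mult ζ′ s o
      eqζ s true  = trans (ζ-over inD s) (sym (ζ-over inD′ s))
      eqζ s false with η ∣? s
      ... | yes (divides m refl) = Rel-ζ m
      ... | no ¬d                = trans (ζ-nonmult inD false ¬d) (sym (ζ-nonmult inD′ false ¬d))
      eqμ : ∀ s o → mult μ s o ≡ mult μ′ s o
      eqμ s o with η ∣? s
      eqμ s false | yes (divides m refl) = Rel-μ m
      eqμ s true  | yes (divides m refl) = trans (b≡0 noOver m) (sym (b≡0 noOver′ m))
      eqμ s false | no ¬d = trans (nonmult-plain sh ¬d) (sym (nonmult-plain sh′ ¬d))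
      eqμ s true  | no ¬d = trans (sym (nonmult-cntKey sh ¬d)) (trans (sym (Rel.nonmult rel s ¬d))
                              (trans (Rel.nonmult rel′ s ¬d) (nonmult-cntKey sh′ ¬d)))

  module _ {ζ μ π π′ : List Part} (rel : Rel n R ζ μ π) (rel′ : Rel n R ζ μ π′)
    (sh : All Shape π) (sh′ : All Shape π′) (adj : AllPairs Adj π) (adj′ : AllPairs Adj π′) where

    -- With `V` fixed, the same part of `ζ` forces the same defect and so the same parity of `a`.
    -- The common total then fixes the parity of `b`, which is at most 1. Induction on `m` supplies
    -- the hypothesis on `V`.
    Rel-level : ∀ m → V π m ≡ V π′ m → a π m ≡ a π′ m × b π m ≡ b π′ m
    Rel-level m V-eq = +-cancelʳ-≡ (b π m) (a π m) (a π′ m) (trans sums (cong (a π′ m +_) (sym b-eq))) , b-eq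
      where
      sums : a π m + b π m ≡ a π′ m + b π′ m
      sums = trans (Rel.total rel m) (sym (Rel.total rel′ m))
      W = suc (R + V π m + suc m * suc n)
      b-eq : b π m ≡ b π′ m
      b-eq with zero-or-positive (a π m + b π m)
      ... | inj₁ z   = trans (m+n≡0⇒n≡0 (a π m) z) (sym (m+n≡0⇒n≡0 (a π′ m) (trans (sym sums) z)))
      ... | inj₂ pos = parity-injective-≤1 (mult-over≤1 adj (m * η)) (mult-over≤1 adj′ (m * η))
          (ℙ.+-cancelˡ-≡ (parity (a π m)) (parity (b π m)) (parity (b π′ m))
            (trans (sym (parity-+ (a π m) (b π m))) (trans (cong parity sums)
              (trans (parity-+ (a π′ m) (b π′ m)) (cong (ℙ._+ parity (b π′ m)) (sym a-parity))))))
        where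
        defects : defect R (suc n) π m ≡ defect R (suc n) π′ m
        defects = pbit-injective _ _ (+-cancelˡ-≡ (a ζ m) _ _
          (trans (Rel.flip rel m pos) (sym (Rel.flip rel′ m (subst (0 <_) sums pos)))))
        a-parity : parity (a π m) ≡ parity (a π′ m)
        a-parity = ℙ.+-cancelʳ-≡ (parity W) (parity (a π m)) (parity (a π′ m))
          (trans (sym (parity-+ (a π m) W)) (trans defects
            (trans (cong (λ v → parity (a π′ m + suc (R + v + suc m * suc n))) (sym V-eq)) (parity-+ (a π′ m) W))))

    Rel-E : ∀ m → E π m ≡ E π′ m
    Rel-E m = nonmult⇒e π π′ (λ s ¬d → trans (Rel.nonmult rel s ¬d) (sym (Rel.nonmult rel′ s ¬d))) (m * η) (suc m * η)

    Rel-V : ∀ m → V π m ≡ V π′ m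
    Rel-V zero    = trans (V0≡0 π) (sym (V0≡0 π′))
    Rel-V (suc m) = trans (V-suc sh m) (trans (cong₂ _+_ (Rel-V m)
      (cong₂ _+_ (proj₂ (Rel-level m (Rel-V m))) (Rel-E m))) (sym (V-suc sh′ m)))

    Rel-functional : π ≡ π′
    Rel-functional = sorted-ext (AllPairs.map Adj⇒code≤ adj) (AllPairs.map Adj⇒code≤ adj′) eq
      where
      eq : ∀ s o → mult π s o ≡ mult π′ s o
      eq s o with η ∣? s
      eq s false | yes (divides m refl) = proj₁ (Rel-level m (Rel-V m))
      eq s true  | yes (divides m refl) = proj₂ (Rel-level m (Rel-V m))
      eq s false | no ¬d = trans (nonmult-plain sh ¬d) (sym (nonmult-plain sh′ ¬d))
      eq s true  | no ¬d = trans (sym (nonmult-cntKey sh ¬d)) (trans (Rel.nonmult rel s ¬d)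
                             (trans (sym (Rel.nonmult rel′ s ¬d)) (nonmult-cntKey sh′ ¬d)))

  -- Construction of π from ζ and μ

  module Forward (ζ μ : List Part) where

    N : ℕ → ℕ
    N m = a μ m + a ζ m

    -- The overline b with d + u = 1, where a = N m ∸ b and v is the number of overlined parts below.
    flag : ℕ → ℕ → Bool
    flag v m = ifPositive (N m) (isOdd (parity (N m + suc (R + v + suc m * suc n) + suc (a ζ m)))) false

    -- Overlining level `m` requires the value of `V m` for the list still to be built. This
    -- recursion predicts it from lower levels, reading the non-multiples off `μ`; `image-V`
    -- confirms the prediction afterwards.
    overBelow : ℕ → ℕ
    overBelow zero    = 0
    overBelow (suc m) = overBelow m + (bit (flag (overBelow m) m) + E μ m)

    β : ℕ → Bool
    β m = flag (overBelow m) m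

    A : ℕ → ℕ
    A = byLevel (λ m → N m ∸ bit (β m)) (λ _ → 0)

    O : ℕ → Bool
    O = byLevel β (λ s → 0 <ᵇ mult μ s true)

    B : ℕ
    B = suc (∣ ζ ∣ₒ + ∣ μ ∣ₒ)

    open Build A O

    image : List Part
    image = build B

    N-beyond : ∀ m → B ≤ m * η → N m ≡ 0
    N-beyond m le = cong₂ _+_ (mult-beyond μ false (≤-trans (s≤s (m≤n+m _ _)) le)) (mult-beyond ζ false (≤-trans (s≤s (m≤m+n _ _)) le))

    β-empty : ∀ m → N m ≡ 0 → β m ≡ false
    β-empty m eq = ifPositive-no eq

    A-support : ∀ s → B ≤ s → A s ≡ 0
    A-support = byLevel-support _ _ B (λ m le → trans (cong (_∸ bit (β m)) (N-beyond m le)) (0∸n≡0 (bit (β m)))) (λ _ _ → refl)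

    O-support : ∀ s → B ≤ s → O s ≡ false
    O-support = byLevel-support _ _ B (λ m le → β-empty m (N-beyond m le))
      (λ s le → cong (0 <ᵇ_) (mult-beyond μ true (≤-trans (s≤s (m≤n+m _ _)) le)))

    image-a : ∀ m → a image m ≡ N m ∸ bit (β m)
    image-a m = trans (mult-plain B A-support O-support (m * η)) (byLevel-mult _ _ m)

    image-b : ∀ m → b image m ≡ bit (β m)
    image-b m = trans (mult-over B A-support O-support (m * η)) (cong bit (byLevel-mult _ _ m))

    image-plain-non : ∀ {s} → ¬ (η ∣ s) → mult image s false ≡ 0
    image-plain-non {s} ¬d = trans (mult-plain B A-support O-support s) (byLevel-non _ _ ¬d)

    image-over-non : ∀ {s} → ¬ (η ∣ s) → mult image s true ≡ bit (0 <ᵇ mult μ s true)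
    image-over-non {s} ¬d = trans (mult-over B A-support O-support s) (cong bit (byLevel-non _ _ ¬d))

    β≤N : ∀ m → bit (β m) ≤ N m
    β≤N m with zero-or-positive (N m)
    ... | inj₁ z   = subst (λ o → bit o ≤ N m) (sym (β-empty m z)) z≤n
    ... | inj₂ pos = ≤-trans (bit≤1 (β m)) pos

    image-Adj : AllPairs Adj image
    image-Adj = build-Adj B

    image-total : ∀ m → a image m + b image m ≡ N m
    image-total m = trans (cong₂ _+_ (image-a m) (image-b m)) (m∸n+n≡m (β≤N m))

    module _ (inD : InD η ζ) (adj : AllPairs Adj μ) (shape : All Shape μ) where

      image-shape : All Shape image
      image-shape = All⇐mult image λ s o pos → positive s o pos , multiple s o pos
        where
        N0 : a image 0 + b image 0 ≡ 0
        N0 = trans (image-total 0) (cong₂ _+_ (a0≡0 shape) (ζ-zero inD))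
        positive : ∀ s o → 0 < mult image s o → 1 ≤ s
        positive (suc s) o     _   = s≤s z≤n
        positive zero    false pos = ⊥-elim (<-irrefl (sym (m+n≡0⇒m≡0 (a image 0) N0)) pos)
        positive zero    true  pos = ⊥-elim (<-irrefl (sym (m+n≡0⇒n≡0 (a image 0) N0)) pos)
        multiple : ∀ s o → 0 < mult image s o → o ≡ false → η ∣ s
        multiple s .false pos refl with η ∣? s
        ... | yes d = d
        ... | no ¬d = ⊥-elim (<-irrefl (sym (image-plain-non ¬d)) pos)

      image-mult-non : ∀ {s} → ¬ (η ∣ s) → mult image s true ≡ mult μ s true
      image-mult-non {s} ¬d = trans (image-over-non ¬d) (bit-0< (mult-over≤1 adj s))

      image-nonmult : ∀ s → ¬ (η ∣ s) → cntKey size image s ≡ cntKey size μ s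
      image-nonmult s ¬d = trans (nonmult-cntKey image-shape ¬d) (trans (image-mult-non ¬d) (sym (nonmult-cntKey shape ¬d)))

      image-V : ∀ m → V image m ≡ overBelow m
      image-V zero    = V0≡0 image
      image-V (suc m) = trans (V-suc image-shape m) (cong₂ _+_ (image-V m)
        (cong₂ _+_ (image-b m) (nonmult⇒e image μ image-nonmult (m * η) (suc m * η))))

      image-flip : ∀ m → 0 < a image m + b image m → a ζ m + pbit (defect R (suc n) image m) ≡ 1
      image-flip m pos = subst (λ p → a ζ m + pbit p ≡ 1) (sym key) (opposite-pbit (ζ≤1 inD m))
        where
        open ≡-Reasoning
        W = suc (R + overBelow m + suc m * suc n)
        x = a image m
        y = bit (β m)
        p = parity (N m + W + suc (a ζ m))
        y-parity : parity y ≡ parity (N m + W + suc (a ζ m))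
        y-parity = trans (cong (parity ∘ bit) (ifPositive-yes (subst (0 <_) (image-total m) pos)))
          (trans (cong parity (bit-isOdd p)) (parity-pbit p))
        shuffle₁ : ∀ x y W → x + W + 2 * y ≡ y + (x + y + W)
        shuffle₁ = solve-∀
        shuffle₂ : ∀ N W d → N + W + d + (N + W) ≡ d + 2 * (N + W)
        shuffle₂ = solve-∀
        -- Since `x` is `N m` minus `y`, adding `2 * y` replaces the subtraction by an addition
        -- without changing parity. The formula in `flag` is this equation solved for `y`.
        key : defect R (suc n) image m ≡ parity (suc (a ζ m))
        key = begin
          defect R (suc n) image m             ≡⟨ cong (λ v → parity (x + suc (R + v + suc m * suc n))) (image-V m) ⟩
          parity (x + W)                       ≡⟨ parity-even y (x + W) ⟨
          parity (x + W + 2 * y)               ≡⟨ cong parity (shuffle₁ x y W) ⟩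
          parity (y + (x + y + W))             ≡⟨ cong (λ z → parity (y + (x + z + W))) (image-b m) ⟨
          parity (y + (x + b image m + W))     ≡⟨ cong (λ z → parity (y + (z + W))) (image-total m) ⟩
          parity (y + (N m + W))               ≡⟨ parity-+-cong y (N m + W + suc (a ζ m)) (N m + W) (N m + W) y-parity refl ⟩
          parity (N m + W + suc (a ζ m) + (N m + W)) ≡⟨ cong parity (shuffle₂ (N m) W (suc (a ζ m))) ⟩
          parity (suc (a ζ m) + 2 * (N m + W)) ≡⟨ parity-even (N m + W) (suc (a ζ m)) ⟩
          parity (suc (a ζ m)) ∎

      image-Rel : Rel n R ζ μ image
      image-Rel = record { total = image-total ; nonmult = image-nonmult ; flip = image-flip }

      image-residues : ∀ {lam} {α : Fin lam → ℕ} →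
        All (λ p → size p % η ≡ 0 ⊎ ∃ λ (i : Fin lam) → size p % η ≡ α i) μ →
        All (λ p → size p % η ≡ 0 ⊎ ∃ λ (i : Fin lam) → size p % η ≡ α i) image
      image-residues {lam} {α} c1 = All⇐mult image residue
        where
        residue : ∀ s o → 0 < mult image s o → s % η ≡ 0 ⊎ ∃ λ (i : Fin lam) → s % η ≡ α i
        residue s o pos with η ∣? s
        residue s o     pos | yes d = inj₁ (n∣m⇒m%n≡0 s η d)
        residue s false pos | no ¬d = ⊥-elim (<-irrefl (sym (image-plain-non ¬d)) pos)
        residue s true  pos | no ¬d = All⇒mult c1 {s} {true} (subst (0 <_) (image-mult-non ¬d) pos)

  -- Recovery of ζ and μ from π

  module Backward (π : List Part) (adj : AllPairs Adj π) (shape : All Shape π) where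

    N : ℕ → ℕ
    N m = a π m + b π m

    -- Both values are forced: `flip` determines the part of `ζ` at an occupied level, and `total`
    -- excludes it at an empty one.
    d : ℕ → ℕ
    d m = ifPositive (N m) (pbit (defect R (suc n) π m ℙ.⁻¹)) 0

    B : ℕ
    B = suc ∣ π ∣ₒ

    N-beyond : ∀ m → B ≤ m * η → N m ≡ 0
    N-beyond m le = cong₂ _+_ (mult-beyond π false le) (mult-beyond π true le)

    d-empty : ∀ m → N m ≡ 0 → d m ≡ 0
    d-empty m eq = ifPositive-no eq

    d≤1 : ∀ m → d m ≤ 1
    d≤1 m with N m
    ... | zero  = z≤n
    ... | suc _ = pbit≤1 _

    d≤N : ∀ m → d m ≤ N m
    d≤N m with zero-or-positive (N m)
    ... | inj₁ z   = subst (_≤ N m) (sym (d-empty m z)) z≤n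
    ... | inj₂ pos = ≤-trans (d≤1 m) pos

    module Z = Build (byLevel d (λ _ → 0)) (λ _ → false)
    module M = Build (byLevel (λ m → N m ∸ d m) (λ _ → 0)) (byLevel (λ _ → false) (λ s → 0 <ᵇ mult π s true))

    ζ μ : List Part
    ζ = Z.build B
    μ = M.build B

    ζ-support : ∀ s → B ≤ s → byLevel d (λ _ → 0) s ≡ 0
    ζ-support = byLevel-support _ _ B (λ m le → d-empty m (N-beyond m le)) (λ _ _ → refl)

    μ-A-support : ∀ s → B ≤ s → byLevel (λ m → N m ∸ d m) (λ _ → 0) s ≡ 0
    μ-A-support = byLevel-support _ _ B (λ m le → trans (cong (_∸ d m) (N-beyond m le)) (0∸n≡0 (d m))) (λ _ _ → refl)

    μ-O-support : ∀ s → B ≤ s → byLevel (λ _ → false) (λ s → 0 <ᵇ mult π s true) s ≡ false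
    μ-O-support = byLevel-support _ _ B (λ _ _ → refl) (λ s le → cong (0 <ᵇ_) (mult-beyond π true le))

    ζ-a : ∀ m → a ζ m ≡ d m
    ζ-a m = trans (Z.mult-plain B ζ-support (λ _ _ → refl) (m * η)) (byLevel-mult _ _ m)

    ζ-plain-non : ∀ {s} → ¬ (η ∣ s) → mult ζ s false ≡ 0
    ζ-plain-non {s} ¬d = trans (Z.mult-plain B ζ-support (λ _ _ → refl) s) (byLevel-non _ _ ¬d)

    ζ-b : ∀ s → mult ζ s true ≡ 0
    ζ-b s = Z.mult-over B ζ-support (λ _ _ → refl) s

    μ-a : ∀ m → a μ m ≡ N m ∸ d m
    μ-a m = trans (M.mult-plain B μ-A-support μ-O-support (m * η)) (byLevel-mult _ _ m)

    μ-b : ∀ m → b μ m ≡ 0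
    μ-b m = trans (M.mult-over B μ-A-support μ-O-support (m * η)) (cong bit (byLevel-mult (λ _ → false) _ m))

    μ-plain-non : ∀ {s} → ¬ (η ∣ s) → mult μ s false ≡ 0
    μ-plain-non {s} ¬d = trans (M.mult-plain B μ-A-support μ-O-support s) (byLevel-non _ _ ¬d)

    μ-over-non : ∀ {s} → ¬ (η ∣ s) → mult μ s true ≡ mult π s true
    μ-over-non {s} ¬d = trans (trans (M.mult-over B μ-A-support μ-O-support s) (cong bit (byLevel-non (λ _ → false) _ ¬d))) (bit-0< (mult-over≤1 adj s))

    N0 : N 0 ≡ 0
    N0 = cong₂ _+_ (a0≡0 shape) (b0≡0 shape)

    ζ-InD : InD η ζ
    ζ-InD = All⇐mult ζ parts , AllPairs⇒Linked (distinct (Z.build-Adj B) few)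
      where
      parts : ∀ s o → 0 < mult ζ s o → 1 ≤ s × o ≡ false × η ∣ s
      parts s true  pos = ⊥-elim (<-irrefl (sym (ζ-b s)) pos)
      parts s false pos with η ∣? s
      ... | no ¬d = ⊥-elim (<-irrefl (sym (ζ-plain-non ¬d)) pos)
      parts zero    false pos | yes d′ = ⊥-elim (<-irrefl (sym (trans (ζ-a 0) (d-empty 0 N0))) pos)
      parts (suc s) false pos | yes d′ = s≤s z≤n , refl , d′
      few : ∀ s o → mult ζ s o ≤ 1
      few s true = subst (_≤ 1) (sym (ζ-b s)) z≤n
      few s false with η ∣? s
      ... | yes (divides m refl) = subst (_≤ 1) (sym (ζ-a m)) (d≤1 m)
      ... | no ¬d                = subst (_≤ 1) (sym (ζ-plain-non ¬d)) z≤n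

    μ-Adj : AllPairs Adj μ
    μ-Adj = M.build-Adj B

    μ-shape : All Shape μ
    μ-shape = All⇐mult μ λ s o pos → positive s o pos , multiple s o pos
      where
      positive : ∀ s o → 0 < mult μ s o → 1 ≤ s
      positive (suc s) o     _   = s≤s z≤n
      positive zero    false pos = ⊥-elim (<-irrefl (sym (trans (μ-a 0) (trans (cong (_∸ d 0) N0) (0∸n≡0 (d 0))))) pos)
      positive zero    true  pos = ⊥-elim (<-irrefl (sym (μ-b 0)) pos)
      multiple : ∀ s o → 0 < mult μ s o → o ≡ false → η ∣ s
      multiple s .false pos refl with η ∣? s
      ... | yes d′ = d′
      ... | no ¬d  = ⊥-elim (<-irrefl (sym (μ-plain-non ¬d)) pos)

    μ-noOver : NoOverMultiple μ
    μ-noOver = All⇐mult μ λ { s .true pos refl (divides m refl) → <-irrefl (sym (μ-b m)) pos }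

    ζμ-Rel : Rel n R ζ μ π
    ζμ-Rel = record
      { total   = λ m → sym (trans (cong₂ _+_ (μ-a m) (ζ-a m)) (m∸n+n≡m (d≤N m)))
      ; nonmult = λ s ¬d → trans (nonmult-cntKey shape ¬d) (trans (sym (μ-over-non ¬d)) (sym (nonmult-cntKey μ-shape ¬d)))
      ; flip    = λ m pos → trans (cong (_+ pbit (defect R (suc n) π m)) (trans (ζ-a m) (ifPositive-yes pos))) (pbit-⁻¹ (defect R (suc n) π m))
      }

    μ-residues : ∀ {lam} {α : Fin lam → ℕ} →
      All (λ p → size p % η ≡ 0 ⊎ ∃ λ (i : Fin lam) → size p % η ≡ α i) π →
      All (λ p → size p % η ≡ 0 ⊎ ∃ λ (i : Fin lam) → size p % η ≡ α i) μ
    μ-residues {lam} {α} c1 = All⇐mult μ residue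
      where
      residue : ∀ s o → 0 < mult μ s o → s % η ≡ 0 ⊎ ∃ λ (i : Fin lam) → s % η ≡ α i
      residue s o pos with η ∣? s
      residue s o     pos | yes d′ = inj₁ (n∣m⇒m%n≡0 s η d′)
      residue s false pos | no ¬d = ⊥-elim (<-irrefl (sym (μ-plain-non ¬d)) pos)
      residue s true  pos | no ¬d = All⇒mult c1 {s} {true} (subst (0 <_) (μ-over-non ¬d) pos)

-- The two cases for r and the final assembly

χ-cases : ∀ r k → (r ≡ k × r ∸ χ= r k ≡ k ∸ 1) ⊎ r ∸ χ= r k ≡ r
χ-cases r k with r ≡ᵇ k in eq
... | false = inj₂ refl
... | true  = let r≡k = ≡ᵇ⇒≡ r k (subst T (sym eq) tt) in inj₁ (r≡k , cong (_∸ 1) r≡k)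

module Main (lam η : ℕ) .{{_ : NonZero η}} (α : Fin lam → ℕ) (n r r′ : ℕ) (lam≤n : lam ≤ n)
            (r-r′ : r′ ≡ r ⊎ (r ≡ 2 + n × r′ ≡ 1 + n)) where

  open Correspondence η n r

  Φ : List Part → List Part → List Part
  Φ ζ μ = Forward.image ζ μ

  adjacent : ∀ {π} → IsOverpartition π → AllPairs Adj π
  adjacent (_ , lnk) = Linked⇒AllPairs Adj-trans lnk

  module _ {ζ μ} (inD : InD η ζ) (inB : InB η α 1 (suc n) r′ μ) where

    private
      shape = InBbar⇒Shape α (proj₁ inB)
      adj = adjacent (InBbar.overpartition (proj₁ inB))

    Φ-Rel : Rel n r ζ μ (Φ ζ μ)
    Φ-Rel = Forward.image-Rel ζ μ inD adj shape

    Φ-shape : All Shape (Φ ζ μ)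
    Φ-shape = Forward.image-shape ζ μ inD adj shape

    Φ-Bbar : InBbar η α 0 (2 + n) r (Φ ζ μ)
    Φ-Bbar = ⇒InBbar0 α (All.map proj₁ Φ-shape , AllPairs⇒Linked (Forward.image-Adj ζ μ))
      (Forward.image-residues ζ μ inD adj shape (InBbar.cond1 (proj₁ inB))) (All.map proj₂ Φ-shape)
      (Transfer.levels⇒ r-r′ Φ-Rel Φ-shape (Forward.image-Adj ζ μ) (proj₂ inB) X≤n (InBbar1⇒ α (proj₁ inB)))
      where
      X≤n : ∀ s → X (Φ ζ μ) s ≤ n
      X≤n s = subst (_≤ n) (sym (nonmult⇒e (Φ ζ μ) μ (Rel.nonmult Φ-Rel) (suc s ∸ η) (suc s)))
        (≤-trans (X≤classes α (InBbar.overpartition (proj₁ inB)) shape (InBbar.cond1 (proj₁ inB)) s) lam≤n)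

    Φ-weight : ∣ Φ ζ μ ∣ₒ ≡ ∣ ζ ∣ₒ + ∣ μ ∣ₒ
    Φ-weight = Rel-weight inD (proj₂ inB) Φ-Rel

  Φ-injective : ∀ ζ μ ζ′ μ′ → InD η ζ → InB η α 1 (suc n) r′ μ → InD η ζ′ → InB η α 1 (suc n) r′ μ′ →
    Φ ζ μ ≡ Φ ζ′ μ′ → ζ ≡ ζ′ × μ ≡ μ′
  Φ-injective ζ μ ζ′ μ′ inD inB inD′ inB′ eq =
    Rel-injective (Φ-Rel inD inB) (subst (Rel n r ζ′ μ′) (sym eq) (Φ-Rel inD′ inB′)) inD inD′
      (overpartition⇒sorted (InBbar.overpartition (proj₁ inB))) (overpartition⇒sorted (InBbar.overpartition (proj₁ inB′)))
      (InBbar⇒Shape α (proj₁ inB)) (InBbar⇒Shape α (proj₁ inB′)) (proj₂ inB) (proj₂ inB′)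

  -- The pair read off from `π` is related to `π` and, once it is known to lie in the domain, to its
  -- own image; `Rel-functional` identifies the two.
  Φ-surjective : ∀ π → InBbar η α 0 (2 + n) r π → ∃₂ λ ζ μ → InD η ζ × InB η α 1 (suc n) r′ μ × Φ ζ μ ≡ π
  Φ-surjective π inBbar = ζ , μ , ζ-InD , inB ,
      Rel-functional (Φ-Rel ζ-InD inB) ζμ-Rel (Φ-shape ζ-InD inB) shape (Forward.image-Adj ζ μ) adj
    where
    shape = InBbar⇒Shape α inBbar
    adj = adjacent (InBbar.overpartition inBbar)
    open Backward π adj shape
    inB : InB η α 1 (suc n) r′ μ
    inB = ⇒InBbar1 α (All.map proj₁ μ-shape , AllPairs⇒Linked μ-Adj) (μ-residues (InBbar.cond1 inBbar)) (All.map proj₂ μ-shape)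
      (Transfer.levels⇐ r-r′ ζμ-Rel shape adj μ-noOver
        (λ s → ≤-trans (X≤classes α (InBbar.overpartition inBbar) shape (InBbar.cond1 inBbar) s) lam≤n)
        (InBbar0⇒ α inBbar)) , μ-noOver

theorem4p1 : (lam η : ℕ) .{{_ : NonZero η}} (α : Fin lam → ℕ) →
    (∀ i → 0 < α i) → (∀ i j → i <ᶠ j → α i < α j) → (∀ i → α i < η) →
    (∀ i → α i ≡ η ∸ α (opposite i)) →
    (k r : ℕ) → r ≤ k → lam ≤ r → lam + 1 < k →
    Σ (List Part → List Part → List Part) λ Φ →
    (∀ ζ μ → InD η ζ → InB η α 1 (k ∸ 1) (r ∸ χ= r k) μ →
    InBbar η α 0 k r (Φ ζ μ) × ∣ Φ ζ μ ∣ₒ ≡ ∣ ζ ∣ₒ + ∣ μ ∣ₒ)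
    × (∀ ζ μ ζ′ μ′ → InD η ζ → InB η α 1 (k ∸ 1) (r ∸ χ= r k) μ →
    InD η ζ′ → InB η α 1 (k ∸ 1) (r ∸ χ= r k) μ′ →
    Φ ζ μ ≡ Φ ζ′ μ′ → ζ ≡ ζ′ × μ ≡ μ′)
    × (∀ π → InBbar η α 0 k r π →
    ∃₂ λ ζ μ → InD η ζ × InB η α 1 (k ∸ 1) (r ∸ χ= r k) μ × Φ ζ μ ≡ π)
theorem4p1 lam η α _ _ _ _ zero          r _ _ lam<k = ⊥-elim (n≮0 lam<k)
theorem4p1 lam η α _ _ _ _ (suc zero)    r _ _ lam<k = ⊥-elim (n≮0 (s≤s⁻¹ (subst (_< 1) (+-comm lam 1) lam<k)))
theorem4p1 lam η α _ _ _ _ (suc (suc n)) r _ _ lam<k =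
    Φ , (λ ζ μ inD inB → Φ-Bbar inD inB , Φ-weight inD inB) , Φ-injective , Φ-surjective
  where
  r-r′ : r ∸ χ= r (2 + n) ≡ r ⊎ (r ≡ 2 + n × r ∸ χ= r (2 + n) ≡ 1 + n)
  r-r′ with χ-cases r (2 + n)
  ... | inj₁ both = inj₂ both
  ... | inj₂ same = inj₁ same
  open Main lam η α n r (r ∸ χ= r (2 + n)) (s≤s⁻¹ (s≤s⁻¹ (subst (_< 2 + n) (+-comm lam 1) lam<k))) r-r′
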